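{- Let $k$ and $m$ be positive integers with $1 < k \leq m-1$. Let $\mathcal F$ be an intersecting family of $k$-multisets of $[m]$ such that $\bigcap_{A \in \mathcal F} A = \emptyset$. Then \[|\mathcal F| \leq \binom{m+k-2}{k-1} - \binom{m-2}{k-1} + 1.\] Moreover, if $3 < k < m-1$, equality holds if and only if $\mathcal F$ is isomorphic to \[\widetilde{\mathcal F} = \{A \text{ a } k\text{ -multiset of } [m] : 1 \in A \text{ and } A \cap [2,k+1] \neq \emptyset\} \cup \{[2,k+1]\}.\]
   Context: A $k$-multiset of $[m]=\{1,\dots,m\}$ is a multiset of cardinality $k$ (counting repetitions) with elements from $[m]$; $\mathrm{m}(i,A)$ denotes the multiplicity of $i$ in $A$. The intersection of multisets $A,B$ is the multiset $C$ with $\mathrm{m}(i,C)=\min\{\mathrm{m}(i,A),\mathrm{m}(i,B)\}$ (a set is regarded as a multiset with all multiplicities one). A family is intersecting if every two members have nonempty intersection. $[x,y]$ denotes $\{x,x+1,\dots,y\}$. Two families are isomorphic if one is obtained from the other by a permutation of $[m]$. -}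

module Defs where

open import Data.Nat using (ℕ; zero; suc; _+_; _∸_; _≤_; _<_; _⊓_; _≤?_)
open import Relation.Nullary using (yes; no)
open import Data.Nat.Combinatorics using (_C_)
open import Data.Fin using (Fin; toℕ)
open import Data.Vec using (Vec; lookup; tabulate; sum)
open import Data.List using (List; length)
open import Data.List.Membership.Propositional using (_∈_)
open import Data.Product using (Σ; ∃; _×_; _,_)
open import Data.Sum using (_⊎_)
open import Function.Bundles using (_↔_; Inverse)
open import Relation.Binary.PropositionalEquality using (_≡_)

-- A multiset over [m] is its multiplicity vector: element j+1 of [m]
-- corresponds to index j : Fin m, and  mult i A  is  m(i+1, A).
Multiset : ℕ → Set
Multiset m = Vec ℕ m

mult : ∀ {m} → Fin m → Multiset m → ℕ
mult i A = lookup A i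

card : ∀ {m} → Multiset m → ℕ
card A = sum A

IsKMultiset : ∀ {m} → ℕ → Multiset m → Set
IsKMultiset k A = card A ≡ k

_∩_ : ∀ {m} → Multiset m → Multiset m → Multiset m
A ∩ B = tabulate (λ i → mult i A ⊓ mult i B)

NonEmpty : ∀ {m} → Multiset m → Set
NonEmpty {m} A = Σ (Fin m) λ i → 0 < mult i A

-- A family is a duplicate-free list of multisets (duplicate-freeness is
-- imposed separately in the statement); |F| = length F.
Intersecting : ∀ {m} → List (Multiset m) → Set
Intersecting F = ∀ {A B} → A ∈ F → B ∈ F → NonEmpty (A ∩ B)

EmptyCommonIntersection : ∀ {m} → List (Multiset m) → Set
EmptyCommonIntersection {m} F =
  (i : Fin m) → Σ (Multiset m) λ A → (A ∈ F) × (mult i A ≡ 0)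

bound : ℕ → ℕ → ℕ
bound m k = ((m + k ∸ 2) C (k ∸ 1)) ∸ ((m ∸ 2) C (k ∸ 1)) + 1

-- membership of element (i+1) in [2, k+1], i.e. 1 ≤ i ≤ k
InSeg : ∀ {m} → ℕ → Fin m → Set
InSeg k i = (1 ≤ toℕ i) × (toℕ i ≤ k)

-- the set [x, y] ⊆ [m] as a multiset (multiplicity one on it, zero elsewhere);
-- index i corresponds to element i+1
interval : ∀ {m} → ℕ → ℕ → Multiset m
interval x y = tabulate (λ i → ind (toℕ i))
  where
  ind : ℕ → ℕ
  ind j with x ≤? suc j | suc j ≤? y
  ... | yes _ | yes _ = 1
  ... | _     | _     = 0

_∈ₘ_ : ∀ {m} → ℕ → Multiset m → Set
x ∈ₘ A = NonEmpty (A ∩ interval x x)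

InFtilde : (m k : ℕ) → Multiset m → Set
InFtilde m k A =
  (IsKMultiset k A × (1 ∈ₘ A) × NonEmpty (A ∩ interval 2 (k + 1)))
  ⊎ (A ≡ interval 2 (k + 1))

-- apply a permutation σ of [m] to a multiset: m(σ i, σ·A) = m(i, A)
permute : ∀ {m} → (Fin m ↔ Fin m) → Multiset m → Multiset m
permute σ A = tabulate (λ i → mult (Inverse.from σ i) A)

IsomorphicTo : ∀ {m} → List (Multiset m) → (Multiset m → Set) → Set
IsomorphicTo {m} F P =
  Σ (Fin m ↔ Fin m) λ σ → ∀ (A : Multiset m) → (A ∈ F → P (permute σ A)) × (P (permute σ A) → A ∈ F)

{-# OPTIONS --safe #-}

-- Sets are Boolean vectors and families are Boolean predicates on them.
--
-- The Hilton-Milner theorem for k-sets of [n], n ≥ 2k, is proved by induction on n, after shifting the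
-- head element towards the others as long as this changes the family.  In a stable family both sections
-- at the head are intersecting, so the induction hypothesis applies to each of them, unless the upper
-- one is a star, which is counted directly; for n = 2k one counts complementary pairs.  Shifting can
-- destroy nontriviality (or the uniqueness of the set avoiding a point) only if all members but at most
-- one meet {head, i}.  In that case the members containing exactly one of these two points form a pair
-- of cross-intersecting families, whose sizes are bounded by the same shifting argument.
--
-- A family F of k-multisets of [m] is sent to the family of k-sets A of [m + k - 1] for which A ∩ [m] is
-- the support of a member of F.  It is intersecting and nontrivial, and at least as large as F because
-- the k - 1 extra points can encode multiplicities.
module Submission where

open import Defs
import Data.Bool.Properties as Bool
open import Data.Bool using (Bool; true; false; not; _∧_; _∨_)
open import Data.Bool.Properties using (∧-zeroʳ; ∧-comm; ∧-identityʳ; ∧-distribʳ-∨; ∨-zeroʳ)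
open import Data.Empty using (⊥; ⊥-elim)
open import Data.Fin using (Fin; zero; suc; fromℕ; fromℕ<; toℕ; punchIn; punchOut; _↑ˡ_; _↑ʳ_; splitAt)
open import Data.Fin.Permutation using (Permutation; _⟨$⟩ʳ_; _⟨$⟩ˡ_; insert; insert-punchIn;
  lift₀; flip; inverseˡ; inverseʳ)
import Data.Fin.Permutation as Perm
open import Data.Fin.Properties using (splitAt⁻¹-↑ˡ; splitAt⁻¹-↑ʳ; toℕ-fromℕ; punchIn-punchOut)
import Data.Fin.Properties as Fin
open import Data.List using (List; []; _∷_; length)
import Data.List as List
import Data.List.Properties as List
import Data.List.Membership.DecPropositional as DecMembership
open import Data.List.Membership.Propositional using (_∈_; find; lose)
open import Data.List.Membership.Propositional.Properties
  using (∈-map⁺; ∈-map⁻; ∈-++⁺ˡ; ∈-++⁺ʳ; ∈-++⁻; ∈-∃++; ∈-length)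
open import Data.List.Relation.Unary.All using (All; []; _∷_)
import Data.List.Relation.Unary.All as All
open import Data.List.Relation.Unary.AllPairs using ([]; _∷_)
open import Data.List.Relation.Unary.Any using (here; there; any?)
open import Data.List.Relation.Unary.Unique.Propositional using (Unique)
import Data.List.Relation.Unary.Unique.Propositional.Properties as Unique
open import Data.Nat
open import Data.Nat.Combinatorics using (nCk+nC[k+1]≡[n+1]C[k+1]; k>n⇒nCk≡0) renaming (_C_ to _choose_)
open import Data.Nat.Induction using (<-wellFounded)
open import Data.Nat.Properties
open import Data.Nat.Tactic.RingSolver using (solve-∀)
open import Data.Product using (Σ; ∃; _×_; _,_; proj₁; proj₂)
open import Data.Sum using (_⊎_; inj₁; inj₂)
import Data.Sum as Sum
open import Data.Vec using (Vec; []; _∷_; lookup; map; replicate; insertAt; removeAt; _[_]≔_; zipWith;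
  take; drop; _++_; sum; tabulate)
open import Data.Vec.Properties using (insertAt-removeAt; insertAt-lookup; insertAt-punchIn; lookup∘tabulate;
  tabulate∘lookup; tabulate-cong; lookup-map; lookup-++ˡ; lookup-++ʳ; lookup-replicate; lookup∘update;
  take++drop≡id; ++-injectiveˡ; ++-injectiveʳ; ≡-dec)
open import Function using (_∘_; _↔_)
open import Function.Bundles using (_⇔_; mk⇔)
open import Induction.WellFounded using (Acc; acc)
open import Relation.Binary.PropositionalEquality hiding ([_])
open import Relation.Nullary using (¬_; contradiction; Dec; yes; no; does)
open import Relation.Nullary.Decidable using (dec-true)

-- For n = m + k - 1 the Hilton-Milner bound C(n-1, k-1) - C(n-k-1, k-1) + 1 is the required one,
-- and n ≥ 2k is the hypothesis k ≤ m - 1.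
--
-- Section bounds are added by Pascal's rule. It treats the main and the subtracted binomials well,
-- but when both sections contribute a summand 1 the total exceeds the goal by 1. In that case the
-- subtracted term of the upper section leaves a surplus binomial that pays for the excess. Once the
-- surplus is at least 2, equality is impossible; k > 3 ensures this.
--
-- The induction records equality only as the existence of a point missed by at most one member, a
-- count that shifts of other points preserve. This is enough to recover the family afterwards. The
-- exceptional member has no repeated elements, since otherwise several choices of extra points
-- would complete its support, and every multiset that could still be added must be present already,
-- since adding it would violate the bound.

private variable
  n m : ℕ

-- Binomial coefficients, Boolean sets and families of sets

bin : ℕ → ℕ → ℕ
bin n       zero    = 1
bin zero    (suc k) = 0
bin (suc n) (suc k) = bin n k + bin n (suc k)

bin≥1 : ∀ {n k} → k ≤ n → 1 ≤ bin n k
bin≥1 {n} {zero}      _         = ≤-refl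
bin≥1 {suc n} {suc k} (s≤s k≤n) = ≤-trans (bin≥1 k≤n) (m≤m+n _ _)

bin≥2 : ∀ {n k} → 1 ≤ k → k < n → 2 ≤ bin n k
bin≥2 {suc n} {suc k} _ (s≤s k<n) = +-mono-≤ (bin≥1 (<⇒≤ k<n)) (bin≥1 k<n)

bin-diag : ∀ n → bin n n ≡ 1
bin-diag zero    = refl
bin-diag (suc n) = cong₂ _+_ (bin-diag n) (bin-above {n} ≤-refl)
  where
  bin-above : ∀ {n k} → n < k → bin n k ≡ 0
  bin-above {zero}  {suc k} _         = refl
  bin-above {suc n} {suc k} (s≤s n<k) = cong₂ _+_ (bin-above n<k) (bin-above (m<n⇒m<1+n n<k))

b2n : Bool → ℕ
b2n true  = 1
b2n false = 0

wt : Vec Bool n → ℕ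
wt []      = 0
wt (a ∷ A) = b2n a + wt A

meets : Vec Bool n → Vec Bool n → Bool
meets []      []      = false
meets (a ∷ A) (b ∷ B) = (a ∧ b) ∨ meets A B

Family : ℕ → Set
Family n = Vec Bool n → Bool

cnt : Family n → ℕ
cnt {zero}  P = b2n (P [])
cnt {suc n} P = cnt (P ∘ (false ∷_)) + cnt (P ∘ (true ∷_))

true≢false : ∀ {b} → b ≡ true → b ≡ false → ⊥
true≢false refl ()

∧-intro : ∀ {a b} → a ≡ true → b ≡ true → a ∧ b ≡ true
∧-intro refl refl = refl

∧-elim : ∀ {a b} → a ∧ b ≡ true → a ≡ true × b ≡ true
∧-elim {true} {true} _ = refl , refl

∨-introʳ : ∀ a {b} → b ≡ true → a ∨ b ≡ true
∨-introʳ a refl = ∨-zeroʳ a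

∨-elim : ∀ {a b} → a ∨ b ≡ true → a ≡ true ⊎ b ≡ true
∨-elim {true}         _ = inj₁ refl
∨-elim {false} {true} _ = inj₂ refl

not-false : ∀ {a} → not a ≡ true → a ≡ false
not-false {false} _ = refl

bool-cases : ∀ b → b ≡ true ⊎ b ≡ false
bool-cases true  = inj₁ refl
bool-cases false = inj₂ refl

≡ᵇ-sound : ∀ {a b} → (a ≡ᵇ b) ≡ true → a ≡ b
≡ᵇ-sound {zero}  {zero}  _ = refl
≡ᵇ-sound {suc a} {suc b} e = cong suc (≡ᵇ-sound e)

≡ᵇ-complete : ∀ {a b} → a ≡ b → (a ≡ᵇ b) ≡ true
≡ᵇ-complete {zero}  refl = refl
≡ᵇ-complete {suc a} refl = ≡ᵇ-complete {a} refl

interchange : ∀ a b c d → (a + b) + (c + d) ≡ (a + c) + (b + d)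
interchange = solve-∀

-- Cardinalities of families

_⊆_ : Family n → Family n → Set
P ⊆ Q = ∀ A → P A ≡ true → Q A ≡ true

cnt-mono : {P Q : Family n} → P ⊆ Q → cnt P ≤ cnt Q
cnt-mono {zero} {P} {Q} P⊆Q with P [] in eq
... | false = z≤n
... | true rewrite P⊆Q [] eq = ≤-refl
cnt-mono {suc n} P⊆Q = +-mono-≤ (cnt-mono (λ A → P⊆Q (false ∷ A))) (cnt-mono (λ A → P⊆Q (true ∷ A)))

cnt-cong : {P Q : Family n} → (∀ A → P A ≡ Q A) → cnt P ≡ cnt Q
cnt-cong P≗Q = ≤-antisym (cnt-mono (λ A p → trans (sym (P≗Q A)) p)) (cnt-mono (λ A q → trans (P≗Q A) q))

cnt-∨-∧ : (P Q : Family n) → cnt (λ A → P A ∨ Q A) + cnt (λ A → P A ∧ Q A) ≡ cnt P + cnt Q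
cnt-∨-∧ {zero} P Q with P [] | Q []
... | true  | true  = refl
... | true  | false = refl
... | false | true  = refl
... | false | false = refl
cnt-∨-∧ {suc n} P Q = begin
  (a + b) + (c + d) ≡⟨ interchange a b c d ⟩
  (a + c) + (b + d) ≡⟨ cong₂ _+_ (cnt-∨-∧ (P ∘ (false ∷_)) _) (cnt-∨-∧ (P ∘ (true ∷_)) _) ⟩
  (e + f) + (g + h) ≡⟨ interchange e f g h ⟩
  (e + g) + (f + h) ∎
  where
  open ≡-Reasoning
  a = cnt (λ A → P (false ∷ A) ∨ Q (false ∷ A))
  b = cnt (λ A → P (true ∷ A) ∨ Q (true ∷ A))
  c = cnt (λ A → P (false ∷ A) ∧ Q (false ∷ A))
  d = cnt (λ A → P (true ∷ A) ∧ Q (true ∷ A))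
  e = cnt (P ∘ (false ∷_))
  f = cnt (Q ∘ (false ∷_))
  g = cnt (P ∘ (true ∷_))
  h = cnt (Q ∘ (true ∷_))

cnt-empty : (P : Family n) → (∀ A → P A ≡ false) → cnt P ≡ 0
cnt-empty {zero}  P e rewrite e [] = refl
cnt-empty {suc n} P e =
  cong₂ _+_ (cnt-empty (P ∘ (false ∷_)) (λ A → e (false ∷ A))) (cnt-empty (P ∘ (true ∷_)) (λ A → e (true ∷ A)))

cnt-disjoint : (P Q R : Family n) → (∀ A → P A ≡ true → Q A ≡ true → ⊥) →
  P ⊆ R → Q ⊆ R → cnt P + cnt Q ≤ cnt R
cnt-disjoint P Q R dis P⊆R Q⊆R = begin
  cnt P + cnt Q                                       ≡⟨ cnt-∨-∧ P Q ⟨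
  cnt (λ A → P A ∨ Q A) + cnt (λ A → P A ∧ Q A)       ≡⟨ cong (cnt (λ A → P A ∨ Q A) +_) (cnt-empty _ ∧-false) ⟩
  cnt (λ A → P A ∨ Q A) + 0                           ≡⟨ +-identityʳ _ ⟩
  cnt (λ A → P A ∨ Q A)                               ≤⟨ cnt-mono ∪⊆R ⟩
  cnt R                                               ∎
  where
  open ≤-Reasoning
  ∧-false : ∀ A → P A ∧ Q A ≡ false
  ∧-false A with bool-cases (P A ∧ Q A)
  ... | inj₂ f = f
  ... | inj₁ t = ⊥-elim (dis A (proj₁ (∧-elim t)) (proj₂ (∧-elim t)))
  ∪⊆R : (λ A → P A ∨ Q A) ⊆ R
  ∪⊆R A t with ∨-elim t
  ... | inj₁ p = P⊆R A p
  ... | inj₂ q = Q⊆R A q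

search : (P : Family n) → (∀ A → P A ≡ false) ⊎ ∃ λ A → P A ≡ true
search {zero} P with P [] in eq
... | false = inj₁ λ { [] → eq }
... | true  = inj₂ ([] , eq)
search {suc n} P with search (P ∘ (false ∷_)) | search (P ∘ (true ∷_))
... | inj₂ (A , p) | _            = inj₂ (false ∷ A , p)
... | inj₁ _       | inj₂ (A , p) = inj₂ (true ∷ A , p)
... | inj₁ e       | inj₁ f       = inj₁ λ { (false ∷ A) → e A ; (true ∷ A) → f A }

member⇒cnt≥1 : (P : Family n) → ∀ A → P A ≡ true → 1 ≤ cnt P
member⇒cnt≥1 P []          p rewrite p = ≤-refl
member⇒cnt≥1 P (false ∷ A) p = ≤-trans (member⇒cnt≥1 _ A p) (m≤m+n _ _)
member⇒cnt≥1 P (true ∷ A)  p = ≤-trans (member⇒cnt≥1 _ A p) (m≤n+m _ _)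

AtMostOne : Family n → Set
AtMostOne P = ∀ {A B} → P A ≡ true → P B ≡ true → A ≡ B

∷-injʳ : ∀ {a b} {A B : Vec Bool n} → a ∷ A ≡ b ∷ B → A ≡ B
∷-injʳ refl = refl

cnt≤1 : (P : Family n) → AtMostOne P → cnt P ≤ 1
cnt≤1 {zero} P u with P []
... | true  = ≤-refl
... | false = z≤n
cnt≤1 {suc n} P u with search (P ∘ (false ∷_)) | search (P ∘ (true ∷_))
... | inj₁ e       | _            rewrite cnt-empty _ e = cnt≤1 _ λ p q → ∷-injʳ (u p q)
... | inj₂ _       | inj₁ e       rewrite cnt-empty _ e | +-identityʳ (cnt (P ∘ (false ∷_))) =
  cnt≤1 _ λ p q → ∷-injʳ (u p q)
... | inj₂ (A , p) | inj₂ (B , q) with () ← u p q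

cnt≤1⇒unique : (P : Family n) → cnt P ≤ 1 → AtMostOne P
cnt≤1⇒unique P c {[]} {[]} p q = refl
cnt≤1⇒unique P c {false ∷ A} {false ∷ B} p q = cong (false ∷_) (cnt≤1⇒unique _ (≤-trans (m≤m+n _ _) c) p q)
cnt≤1⇒unique P c {true ∷ A}  {true ∷ B}  p q = cong (true ∷_) (cnt≤1⇒unique _ (≤-trans (m≤n+m _ _) c) p q)
cnt≤1⇒unique P c {false ∷ A} {true ∷ B}  p q =
  contradiction (≤-trans (+-mono-≤ (member⇒cnt≥1 _ A p) (member⇒cnt≥1 _ B q)) c) λ { (s≤s ()) }
cnt≤1⇒unique P c {true ∷ A}  {false ∷ B} p q =
  contradiction (≤-trans (+-mono-≤ (member⇒cnt≥1 _ B q) (member⇒cnt≥1 _ A p)) c) λ { (s≤s ()) }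

-- Passes tightness of a sum on to both summands; this is how equality in an added-up bound reaches
-- its parts.
+-split-≤ : ∀ {a b c d} → a ≤ c → b ≤ d → c + d ≤ a + b → c ≤ a × d ≤ b
+-split-≤ {a} {b} {c} {d} a≤c b≤d h =
  +-cancelʳ-≤ d c a (≤-trans h (+-monoʳ-≤ a b≤d)) , +-cancelˡ-≤ c d b (≤-trans h (+-monoˡ-≤ b a≤c))

cnt-full : {P Q : Family n} → P ⊆ Q → cnt Q ≤ cnt P → Q ⊆ P
cnt-full {zero} {P} {Q} s h [] q with P []
... | true = refl
... | false rewrite q with () ← h
cnt-full {suc n} {P} {Q} s h = by-head
  where
  sections = +-split-≤ (cnt-mono {P = P ∘ (false ∷_)} {Q ∘ (false ∷_)} (λ A → s (false ∷ A)))
                       (cnt-mono {P = P ∘ (true ∷_)} {Q ∘ (true ∷_)} (λ A → s (true ∷ A))) h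
  by-head : Q ⊆ P
  by-head (false ∷ A) q = cnt-full (λ A → s (false ∷ A)) (proj₁ sections) A q
  by-head (true ∷ A)  q = cnt-full (λ A → s (true ∷ A)) (proj₂ sections) A q

cnt-strict : {P Q : Family n} → P ⊆ Q → ∀ A → Q A ≡ true → P A ≡ false → cnt P < cnt Q
cnt-strict P⊆Q A q p = ≰⇒> λ h → true≢false (cnt-full P⊆Q h A q) p

cnt-insert : (P : Family (suc n)) (x : Fin (suc n)) →
  cnt P ≡ cnt (λ R → P (insertAt R x false)) + cnt (λ R → P (insertAt R x true))
cnt-insert P zero = refl
cnt-insert {suc n} P (suc x) =
  trans (cong₂ _+_ (cnt-insert (P ∘ (false ∷_)) x) (cnt-insert (P ∘ (true ∷_)) x)) (interchange a b c d)
  where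
  a = cnt λ R → P (false ∷ insertAt R x false)
  b = cnt λ R → P (false ∷ insertAt R x true)
  c = cnt λ R → P (true ∷ insertAt R x false)
  d = cnt λ R → P (true ∷ insertAt R x true)

cnt-complement : (P : Family n) → cnt (P ∘ map not) ≡ cnt P
cnt-complement {zero}  P = refl
cnt-complement {suc n} P = trans (+-comm (cnt (P ∘ map not ∘ (false ∷_))) _)
  (cong₂ _+_ (cnt-complement (P ∘ (false ∷_))) (cnt-complement (P ∘ (true ∷_))))

-- Weights and meeting sets

meets-comm : (A B : Vec Bool n) → meets A B ≡ meets B A
meets-comm []      []      = refl
meets-comm (a ∷ A) (b ∷ B) = cong₂ _∨_ (∧-comm a b) (meets-comm A B)

meets-intro : (A B : Vec Bool n) (i : Fin n) → lookup A i ≡ true → lookup B i ≡ true → meets A B ≡ true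
meets-intro (true ∷ A) (true ∷ B) zero    _ _ = refl
meets-intro (a ∷ A)    (b ∷ B)    (suc i) p q = ∨-introʳ (a ∧ b) (meets-intro A B i p q)

meets-elim : (A B : Vec Bool n) → meets A B ≡ true → ∃ λ i → lookup A i ≡ true × lookup B i ≡ true
meets-elim []          []          ()
meets-elim (true ∷ A)  (true ∷ B)  _ = zero , refl , refl
meets-elim (true ∷ A)  (false ∷ B) t = let i , p = meets-elim A B t in suc i , p
meets-elim (false ∷ A) (b ∷ B)     t = let i , p = meets-elim A B t in suc i , p

meets-insert : (A B : Vec Bool n) (i : Fin (suc n)) (a b : Bool) →
  meets (insertAt A i a) (insertAt B i b) ≡ (a ∧ b) ∨ meets A B
meets-insert A       B       zero    a b = refl
meets-insert (c ∷ A) (d ∷ B) (suc i) a b rewrite meets-insert A B i a b = exchange (c ∧ d) (a ∧ b) (meets A B)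
  where
  exchange : ∀ u v w → u ∨ (v ∨ w) ≡ v ∨ (u ∨ w)
  exchange true  true  w = refl
  exchange true  false w = refl
  exchange false v     w = refl

meets-complement : (A : Vec Bool n) → meets A (map not A) ≡ false
meets-complement []          = refl
meets-complement (true ∷ A)  = meets-complement A
meets-complement (false ∷ A) = meets-complement A

wt-complement : (A : Vec Bool n) → wt (map not A) + wt A ≡ n
wt-complement []          = refl
wt-complement (true ∷ A)  = trans (+-suc _ _) (cong suc (wt-complement A))
wt-complement (false ∷ A) = cong suc (wt-complement A)

wt≤n : (A : Vec Bool n) → wt A ≤ n
wt≤n []          = z≤n
wt≤n (true ∷ A)  = s≤s (wt≤n A)
wt≤n (false ∷ A) = m≤n⇒m≤1+n (wt≤n A)

wt-insert : (A : Vec Bool n) (i : Fin (suc n)) (a : Bool) → wt (insertAt A i a) ≡ b2n a + wt A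
wt-insert A       zero    a = refl
wt-insert (c ∷ A) (suc i) a rewrite wt-insert A i a = exchange (b2n c) (b2n a) (wt A)
  where
  exchange : ∀ u v w → u + (v + w) ≡ v + (u + w)
  exchange = solve-∀

Uniform : ℕ → Family n → Set
Uniform k P = ∀ A → P A ≡ true → wt A ≡ k

cnt-wt : ∀ n k → cnt {n} (λ A → wt A ≡ᵇ k) ≡ bin n k
cnt-wt zero    zero    = refl
cnt-wt zero    (suc k) = refl
cnt-wt (suc n) zero    = cong₂ _+_ (cnt-wt n zero) (cnt-empty {n} _ λ _ → refl)
cnt-wt (suc n) (suc k) = trans (+-comm (cnt {n} (λ A → wt A ≡ᵇ suc k)) _) (cong₂ _+_ (cnt-wt n k) (cnt-wt n (suc k)))

uniform⇒cnt≤bin : ∀ {k} {P : Family n} → Uniform k P → cnt P ≤ bin n k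
uniform⇒cnt≤bin {n} {k} u = ≤-trans (cnt-mono λ A p → ≡ᵇ-complete (u A p)) (≤-reflexive (cnt-wt n k))

cnt-missing : (B : Vec Bool n) (r k : ℕ) → wt B + r ≡ n →
  cnt (λ A → (wt A ≡ᵇ k) ∧ not (meets A B)) ≡ bin r k
cnt-missing []      zero    zero    _ = refl
cnt-missing []      zero    (suc k) _ = refl
cnt-missing {suc n} (true ∷ B) r k e =
  trans (cong₂ _+_ (cnt-missing B r k (suc-injective e))
    (cnt-empty {n} (λ A → (suc (wt A) ≡ᵇ k) ∧ false) λ A → ∧-zeroʳ (suc (wt A) ≡ᵇ k))) (+-identityʳ _)
cnt-missing {suc n} (false ∷ B) zero k e = contradiction (≤-trans (≤-reflexive (trans (sym e) (+-identityʳ _))) (wt≤n B)) 1+n≰n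
cnt-missing (false ∷ B) (suc r) zero e =
  trans (cong₂ _+_ (cnt-missing B r zero (suc-injective (trans (sym (+-suc (wt B) r)) e)))
    (cnt-empty (λ A → (suc (wt A) ≡ᵇ 0) ∧ not (meets A B)) λ _ → refl)) (+-identityʳ _)
cnt-missing (false ∷ B) (suc r) (suc k) e =
  trans (+-comm (cnt (λ A → (wt A ≡ᵇ suc k) ∧ not (meets A B))) _)
    (cong₂ _+_ (cnt-missing B r k e′) (cnt-missing B r (suc k) e′))
  where e′ = suc-injective (trans (sym (+-suc (wt B) r)) e)

-- `B` leaves `r` points, so `bin r k` of the `k`-sets are disjoint from it, and none of them lies
-- in `P`.
cnt-meeting : (B : Vec Bool n) (r k : ℕ) → wt B + r ≡ n → {P : Family n} → Uniform k P →
  (∀ A → P A ≡ true → meets A B ≡ true) → cnt P + bin r k ≤ bin n k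
cnt-meeting {n} B r k e {P} u m = begin
  cnt P + bin r k ≡⟨ cong (cnt P +_) (cnt-missing B r k e) ⟨
  cnt P + cnt (λ A → (wt A ≡ᵇ k) ∧ not (meets A B)) ≤⟨ cnt-disjoint P _ (λ A → wt A ≡ᵇ k)
     (λ A p q → true≢false (m A p) (not-false (proj₂ (∧-elim q)))) (λ A p → ≡ᵇ-complete (u A p)) (λ A q → proj₁ (∧-elim q)) ⟩
  cnt {n} (λ A → wt A ≡ᵇ k) ≡⟨ cnt-wt n k ⟩
  bin n k ∎
  where open ≤-Reasoning

cnt-meeting-full : (B : Vec Bool n) (r k : ℕ) → wt B + r ≡ n → {P : Family n} → Uniform k P →
  (∀ A → P A ≡ true → meets A B ≡ true) → bin n k ≤ cnt P + bin r k →
  ∀ A → wt A ≡ k → meets A B ≡ true → P A ≡ true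
cnt-meeting-full {n} B r k e {P} u m h A w t =
  cnt-full {P = P} {Q = λ A → (wt A ≡ᵇ k) ∧ meets A B} (λ A p → ∧-intro (≡ᵇ-complete (u A p)) (m A p))
    (+-cancelʳ-≤ (bin r k) _ _ (≤-trans (cnt-meeting B r k e
      (λ A q → ≡ᵇ-sound (proj₁ (∧-elim q))) (λ A q → proj₂ (∧-elim {wt A ≡ᵇ k} q))) h))
    A (∧-intro (≡ᵇ-complete w) t)

-- Supply of elements and of sets

_∪_ : Vec Bool n → Vec Bool n → Vec Bool n
_∪_ = zipWith _∨_

wt-∪ : (A B : Vec Bool n) → wt (A ∪ B) ≤ wt A + wt B
wt-∪ []          []          = z≤n
wt-∪ (true ∷ A)  (true ∷ B)  = s≤s (≤-trans (wt-∪ A B) (+-monoʳ-≤ (wt A) (n≤1+n _)))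
wt-∪ (true ∷ A)  (false ∷ B) = s≤s (wt-∪ A B)
wt-∪ (false ∷ A) (true ∷ B)  = ≤-trans (s≤s (wt-∪ A B)) (≤-reflexive (sym (+-suc _ _)))
wt-∪ (false ∷ A) (false ∷ B) = wt-∪ A B

∪-false : (A B : Vec Bool n) (i : Fin n) → lookup (A ∪ B) i ≡ false → lookup A i ≡ false × lookup B i ≡ false
∪-false (false ∷ A) (false ∷ B) zero    _ = refl , refl
∪-false (a ∷ A)     (b ∷ B)     (suc i) f = ∪-false A B i f

missing-element : (A : Vec Bool n) → wt A < n → ∃ λ i → lookup A i ≡ false
missing-element (false ∷ A) _       = zero , refl
missing-element (true ∷ A)  (s≤s h) = let i , f = missing-element A h in suc i , f

missing-both : (A B : Vec Bool n) → wt A + wt B < n → ∃ λ i → lookup A i ≡ false × lookup B i ≡ false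
missing-both A B h = let i , f = missing-element (A ∪ B) (≤-<-trans (wt-∪ A B) h) in i , ∪-false A B i f

wt-add : (A : Vec Bool n) (i : Fin n) → lookup A i ≡ false → wt (A [ i ]≔ true) ≡ suc (wt A)
wt-add (false ∷ A) zero    _ = refl
wt-add (a ∷ A)     (suc i) f = trans (cong (b2n a +_) (wt-add A i f)) (+-suc _ _)

missing⇒wt< : (A : Vec Bool n) (i : Fin n) → lookup A i ≡ false → wt A < n
missing⇒wt< A i f = ≤-trans (≤-reflexive (sym (wt-add A i f))) (wt≤n (A [ i ]≔ true))

fill : (C : Vec Bool n) (j : ℕ) → j + wt C ≤ n → ∃ λ D → wt D ≡ j × meets D C ≡ false
fill []          zero    _ = [] , refl , refl
fill {suc n} (true ∷ C)  j h =
  let D , w , m = fill C j (≤-pred (≤-trans (≤-reflexive (sym (+-suc j _))) h)) in false ∷ D , w , m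
fill (false ∷ C) zero    h = let D , w , m = fill C 0 (wt≤n C) in false ∷ D , w , m
fill (false ∷ C) (suc j) h = let D , w , m = fill C j (≤-pred h) in true ∷ D , cong suc w , m

-- Serves the equality cases: it yields a set that meets an exceptional set at `y` but misses a
-- competing set `C`.
fill-with : (C : Vec Bool n) (j : ℕ) (y : Fin n) → lookup C y ≡ false → suc j + wt C ≤ n →
  ∃ λ D → wt D ≡ suc j × meets D C ≡ false × lookup D y ≡ true
fill-with (false ∷ C) j zero f h =
  let D , w , m = fill C j (≤-pred h) in true ∷ D , cong suc w , m , refl
fill-with (true ∷ C) j (suc y) f h =
  let D , w , m , t = fill-with C j y f (≤-pred (≤-trans (≤-reflexive (sym (+-suc (suc j) _))) h)) in false ∷ D , w , m , t
fill-with (false ∷ C) zero (suc y) f h =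
  let D , w , m , t = fill-with C 0 y f (missing⇒wt< C y f) in false ∷ D , w , m , t
fill-with (false ∷ C) (suc j) (suc y) f h =
  let D , w , m , t = fill-with C j y f (≤-pred h) in true ∷ D , cong suc w , m , t

-- Inclusion of `Y` in a set that is not larger forces equality, so otherwise some point of `Y` lies
-- outside `B`.
equal-or-differ : (Y B : Vec Bool n) → wt B ≤ wt Y → Y ≡ B ⊎ ∃ λ y → lookup Y y ≡ true × lookup B y ≡ false
equal-or-differ []          []          _ = inj₁ refl
equal-or-differ (true ∷ Y)  (false ∷ B) _ = inj₂ (zero , refl , refl)
equal-or-differ (true ∷ Y)  (true ∷ B)  h with equal-or-differ Y B (≤-pred h)
... | inj₁ e       = inj₁ (cong (true ∷_) e)
... | inj₂ (y , p) = inj₂ (suc y , p)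
equal-or-differ (false ∷ Y) (false ∷ B) h with equal-or-differ Y B h
... | inj₁ e       = inj₁ (cong (false ∷_) e)
... | inj₂ (y , p) = inj₂ (suc y , p)
equal-or-differ (false ∷ Y) (true ∷ B)  h with equal-or-differ Y B (<⇒≤ h)
... | inj₁ refl    = contradiction h 1+n≰n
... | inj₂ (y , p) = inj₂ (suc y , p)

Cross : Family n → Family n → Set
Cross P Q = ∀ A B → P A ≡ true → Q B ≡ true → meets A B ≡ true

-- Shifting

-- compress acts on the first two entries; precomposing with move i lets it act on the head and any other entry.
move : Fin (suc n) → Vec Bool (2 + n) → Vec Bool (2 + n)
move i (h ∷ b ∷ R) = h ∷ insertAt R i b

unmove : Fin (suc n) → Vec Bool (2 + n) → Vec Bool (2 + n)
unmove i (h ∷ A) = h ∷ lookup A i ∷ removeAt A i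

move-unmove : (i : Fin (suc n)) (A : Vec Bool (2 + n)) → move i (unmove i A) ≡ A
move-unmove i (h ∷ A) = cong (h ∷_) (insertAt-removeAt A i)

wt-move : (i : Fin (suc n)) (A : Vec Bool (2 + n)) → wt (move i A) ≡ wt A
wt-move i (h ∷ b ∷ R) = cong (b2n h +_) (wt-insert R i b)

meets-move : (i : Fin (suc n)) (A B : Vec Bool (2 + n)) → meets (move i A) (move i B) ≡ meets A B
meets-move i (h ∷ b ∷ R) (h′ ∷ b′ ∷ R′) = cong (h ∧ h′ ∨_) (meets-insert R R′ i b b′)

cnt-move : (i : Fin (suc n)) (P : Family (2 + n)) → cnt (P ∘ move i) ≡ cnt P
cnt-move i P = cong₂ _+_ (sym (cnt-insert (P ∘ (false ∷_)) i)) (sym (cnt-insert (P ∘ (true ∷_)) i))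

cnt-move-head : (i : Fin (suc n)) (P : Family (2 + n)) → cnt (P ∘ move i ∘ (true ∷_)) ≡ cnt (P ∘ (true ∷_))
cnt-move-head i P = sym (cnt-insert (P ∘ (true ∷_)) i)

move-index : Fin (suc n) → Fin (2 + n) → Fin (2 + n)
move-index i zero          = zero
move-index i (suc zero)    = suc i
move-index i (suc (suc x)) = suc (punchIn i x)

lookup-move : (i : Fin (suc n)) (A : Vec Bool (2 + n)) (x : Fin (2 + n)) →
  lookup (move i A) (move-index i x) ≡ lookup A x
lookup-move i (h ∷ b ∷ R) zero          = refl
lookup-move i (h ∷ b ∷ R) (suc zero)    = insertAt-lookup R i b
lookup-move i (h ∷ b ∷ R) (suc (suc x)) = insertAt-punchIn R i b x

compress : Family (2 + n) → Family (2 + n)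
compress P (false ∷ false ∷ R) = P (false ∷ false ∷ R)
compress P (false ∷ true ∷ R)  = P (false ∷ true ∷ R) ∨ P (true ∷ false ∷ R)
compress P (true ∷ false ∷ R)  = P (false ∷ true ∷ R) ∧ P (true ∷ false ∷ R)
compress P (true ∷ true ∷ R)   = P (true ∷ true ∷ R)

cnt-compress : (P : Family (2 + n)) → cnt (compress P) ≡ cnt P
cnt-compress P = begin
  (a + u) + (v + d) ≡⟨ regroup a u v d ⟩
  a + (u + v) + d   ≡⟨ cong (λ x → a + x + d) (cnt-∨-∧ (P ∘ (false ∷_) ∘ (true ∷_)) (P ∘ (true ∷_) ∘ (false ∷_))) ⟩
  a + (b + c) + d   ≡⟨ regroup a b c d ⟨
  (a + b) + (c + d) ∎
  where
  open ≡-Reasoning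
  regroup : ∀ a b c d → (a + b) + (c + d) ≡ a + (b + c) + d
  regroup = solve-∀
  a = cnt (P ∘ (false ∷_) ∘ (false ∷_))
  b = cnt (P ∘ (false ∷_) ∘ (true ∷_))
  c = cnt (P ∘ (true ∷_) ∘ (false ∷_))
  d = cnt (P ∘ (true ∷_) ∘ (true ∷_))
  u = cnt (compress P ∘ (false ∷_) ∘ (true ∷_))
  v = cnt (compress P ∘ (true ∷_) ∘ (false ∷_))

uniform-compress : ∀ {k} {P : Family (2 + n)} → Uniform k P → Uniform k (compress P)
uniform-compress u (false ∷ false ∷ R) p = u _ p
uniform-compress u (true ∷ true ∷ R)   p = u _ p
uniform-compress u (true ∷ false ∷ R)  p = u _ (proj₂ (∧-elim p))
uniform-compress u (false ∷ true ∷ R)  p with ∨-elim p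
... | inj₁ q = u _ q
... | inj₂ q = u _ q

-- The delicate pair has one set with only the second point and one with only the head. The latter
-- has survived the shift, so its shifted copy is a member too. Whichever original the former has,
-- it meets the one of these two sets that shares neither of the first two points with it, so the
-- tails meet.
cross-compress : {P Q : Family (2 + n)} → Cross P Q → Cross (compress P) (compress Q)
cross-compress c (false ∷ false ∷ R) (false ∷ false ∷ S) p q = c _ _ p q
cross-compress c (false ∷ false ∷ R) (true ∷ false ∷ S)  p q = c _ _ p (proj₂ (∧-elim q))
cross-compress c (false ∷ false ∷ R) (true ∷ true ∷ S)   p q = c _ _ p q
cross-compress c (false ∷ false ∷ R) (false ∷ true ∷ S)  p q with ∨-elim q
... | inj₁ q′ = c (false ∷ false ∷ R) (false ∷ true ∷ S) p q′
... | inj₂ q′ = c (false ∷ false ∷ R) (true ∷ false ∷ S) p q′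
cross-compress c (true ∷ false ∷ R)  (false ∷ false ∷ S) p q = c _ _ (proj₂ (∧-elim p)) q
cross-compress c (true ∷ true ∷ R)   (false ∷ false ∷ S) p q = c _ _ p q
cross-compress c (false ∷ true ∷ R)  (false ∷ false ∷ S) p q with ∨-elim p
... | inj₁ p′ = c (false ∷ true ∷ R) (false ∷ false ∷ S) p′ q
... | inj₂ p′ = c (true ∷ false ∷ R) (false ∷ false ∷ S) p′ q
cross-compress c (false ∷ true ∷ R)  (true ∷ false ∷ S)  p q with ∨-elim p | ∧-elim q
... | inj₁ p′ | q₁ , q₂ = c (false ∷ true ∷ R) (true ∷ false ∷ S) p′ q₂
... | inj₂ p′ | q₁ , q₂ = c (true ∷ false ∷ R) (false ∷ true ∷ S) p′ q₁
cross-compress c (true ∷ false ∷ R)  (false ∷ true ∷ S)  p q with ∧-elim p | ∨-elim q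
... | p₁ , p₂ | inj₁ q′ = c (true ∷ false ∷ R) (false ∷ true ∷ S) p₂ q′
... | p₁ , p₂ | inj₂ q′ = c (false ∷ true ∷ R) (true ∷ false ∷ S) p₁ q′
cross-compress c (false ∷ true ∷ R)  (false ∷ true ∷ S)  p q = refl
cross-compress c (false ∷ true ∷ R)  (true ∷ true ∷ S)   p q = refl
cross-compress c (true ∷ _ ∷ R)      (true ∷ _ ∷ S)      p q = refl
cross-compress c (true ∷ true ∷ R)   (false ∷ true ∷ S)  p q = refl

compress-nonempty : {P : Family (2 + n)} → (∃ λ A → P A ≡ true) → ∃ λ A → compress P A ≡ true
compress-nonempty (false ∷ false ∷ R , p) = false ∷ false ∷ R , p
compress-nonempty {P = P} (false ∷ true ∷ R , p) = false ∷ true ∷ R , cong (_∨ P (true ∷ false ∷ R)) p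
compress-nonempty {P = P} (true ∷ false ∷ R , p) = false ∷ true ∷ R , ∨-introʳ (P (false ∷ true ∷ R)) p
compress-nonempty (true ∷ true ∷ R , p) = true ∷ true ∷ R , p

compress-head⊆ : (P : Family (2 + n)) → (compress P ∘ (true ∷_)) ⊆ (P ∘ (true ∷_))
compress-head⊆ P (false ∷ R) p = proj₂ (∧-elim p)
compress-head⊆ P (true ∷ R)  p = p

Stable : Family (suc n) → Set
Stable P = ∀ D i → P (true ∷ D) ≡ true → lookup D i ≡ false → P (false ∷ D [ i ]≔ true) ≡ true

Unstable : Family (2 + n) → Fin (suc n) → Set
Unstable P i = ∃ λ R → P (true ∷ insertAt R i false) ≡ true × P (false ∷ insertAt R i true) ≡ false

all-or-some : {A B : Fin n → Set} → (∀ i → A i ⊎ B i) → (∀ i → A i) ⊎ ∃ B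
all-or-some {zero}  d = inj₁ λ ()
all-or-some {suc n} d with d zero | all-or-some (d ∘ suc)
... | inj₂ b | _            = inj₂ (zero , b)
... | inj₁ _ | inj₂ (i , b) = inj₂ (suc i , b)
... | inj₁ a | inj₁ f       = inj₁ λ { zero → a ; (suc i) → f i }

insertAt-removeAt-at : (D : Vec Bool (suc n)) (i : Fin (suc n)) {b : Bool} → lookup D i ≡ b → insertAt (removeAt D i) i b ≡ D
insertAt-removeAt-at D i refl = insertAt-removeAt D i

insertAt-removeAt-set : (D : Vec Bool (suc n)) (i : Fin (suc n)) (b : Bool) → insertAt (removeAt D i) i b ≡ D [ i ]≔ b
insertAt-removeAt-set (x ∷ D)         zero    b = refl
insertAt-removeAt-set (x ∷ D@(_ ∷ _)) (suc i) b = cong (x ∷_) (insertAt-removeAt-set D i b)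

stable? : (P : Family (2 + n)) → Stable P ⊎ ∃ (Unstable P)
stable? {n} P with all-or-some step
  where
  bad : Fin (suc n) → Family n
  bad i R = P (true ∷ insertAt R i false) ∧ not (P (false ∷ insertAt R i true))
  step : ∀ i → (∀ R → bad i R ≡ false) ⊎ Unstable P i
  step i with search (bad i)
  ... | inj₁ e       = inj₁ e
  ... | inj₂ (R , t) = inj₂ (R , proj₁ (∧-elim t) , not-false (proj₂ (∧-elim {P (true ∷ insertAt R i false)} t)))
... | inj₂ u = inj₂ u
... | inj₁ e = inj₁ stable
  where
  stable : Stable P
  stable D i p f with e i (removeAt D i)
  ... | b rewrite insertAt-removeAt-at D i f | insertAt-removeAt-set D i true | p
    with P (false ∷ D [ i ]≔ true) | b
  ... | true | _ = refl

-- Makes the size of the head section a termination measure: compression only removes sets from it,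
-- and the witness of instability is among those removed.
compress-decreases : (P : Family (2 + n)) (i : Fin (suc n)) → Unstable P i →
  cnt (compress (P ∘ move i) ∘ (true ∷_)) < cnt (P ∘ (true ∷_))
compress-decreases P i (R , t , f) =
  ≤-trans (cnt-strict (compress-head⊆ (P ∘ move i)) (false ∷ R) t (cong (_∧ P (true ∷ insertAt R i false)) f))
    (≤-reflexive (cnt-move-head i P))

compress-nonincreasing : (P : Family (2 + n)) (i : Fin (suc n)) →
  cnt (compress (P ∘ move i) ∘ (true ∷_)) ≤ cnt (P ∘ (true ∷_))
compress-nonincreasing P i =
  ≤-trans (cnt-mono (compress-head⊆ (P ∘ move i))) (≤-reflexive (cnt-move-head i P))

uniform-move : ∀ {k} {P : Family (2 + n)} (i : Fin (suc n)) → Uniform k P → Uniform k (P ∘ move i)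
uniform-move i u A p = trans (sym (wt-move i A)) (u (move i A) p)

cross-move : {P Q : Family (2 + n)} (i : Fin (suc n)) → Cross P Q → Cross (P ∘ move i) (Q ∘ move i)
cross-move i c A B p q = trans (sym (meets-move i A B)) (c _ _ p q)

cnt-compress-move : (P : Family (2 + n)) (i : Fin (suc n)) → cnt (compress (P ∘ move i)) ≡ cnt P
cnt-compress-move P i = trans (cnt-compress (P ∘ move i)) (cnt-move i P)

nonempty-move : {P : Family (2 + n)} (i : Fin (suc n)) → (∃ λ A → P A ≡ true) → ∃ λ A → P (move i A) ≡ true
nonempty-move {P = P} i (A , p) = unmove i A , trans (cong P (move-unmove i A)) p

-- Sections of stable families

lookup-wt0 : (A : Vec Bool n) (i : Fin n) → wt A ≡ 0 → lookup A i ≡ true → ⊥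
lookup-wt0 (true ∷ A)  zero    () t
lookup-wt0 (false ∷ A) (suc i) w  t = lookup-wt0 A i w t

meets-wt0 : (A B : Vec Bool n) → wt A ≡ 0 → meets A B ≡ true → ⊥
meets-wt0 A B w m = let i , a , _ = meets-elim A B m in lookup-wt0 A i w a

meets-update : (D E : Vec Bool n) (i : Fin n) → lookup E i ≡ false → meets (D [ i ]≔ true) E ≡ true → meets D E ≡ true
meets-update (d ∷ D)     (false ∷ E) zero    _ m rewrite ∧-zeroʳ d = m
meets-update (d ∷ D)     (e ∷ E)     (suc i) f m with ∨-elim {d ∧ e} m
... | inj₁ t rewrite t = refl
... | inj₂ t = ∨-introʳ (d ∧ e) (meets-update D E i f t)

stable-section-nonempty : ∀ {k} {P : Family (suc n)} → k < suc n → Uniform k P → Stable P → (∃ λ A → P A ≡ true) →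
  ∃ λ A → P (false ∷ A) ≡ true
stable-section-nonempty k≤n u st (false ∷ A , p) = A , p
stable-section-nonempty k≤n u st (true ∷ A , p) =
  let i , f = missing-element A (≤-pred (≤-trans (≤-reflexive (cong suc (u _ p))) k≤n)) in _ , st A i p f

-- Some point is missed by both `A` and `B`. Exchanging the head of `true ∷ A` for it gives a member
-- of `P` by stability, and this member can meet `true ∷ B` only inside `A`.
cross-section : ∀ {k} {P Q : Family (suc n)} → k + k < n → Uniform (suc k) P → Uniform (suc k) Q → Stable P →
  Cross P Q → Cross (P ∘ (true ∷_)) (Q ∘ (true ∷_))
cross-section {k = k} h u v st c A B p q =
  let a = suc-injective (u _ p)
      b = suc-injective (v _ q)
      i , f , g = missing-both A B (subst₂ (λ x y → x + y < _) (sym a) (sym b) h)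
  in meets-update A B i g (c (false ∷ A [ i ]≔ true) (true ∷ B) (st A i p f) q)

-- Cross-intersecting families

-- Here s = n - k; the subtracted binomial stands on the left-hand side to avoid truncated subtraction.
CIBound : (n k s p q : ℕ) → Set
CIBound n k s p q =
  (p + q + bin s k ≤ bin n k + 1) × (3 ≤ k → k < s → bin n k + 1 ≤ p + q + bin s k → p ≤ 1 ⊎ q ≤ 1)

CrossTheorem : ℕ → Set
CrossTheorem n = ∀ k s → n ≡ k + s → k ≤ s → (P Q : Family n) → Uniform k P → Uniform k Q → Cross P Q →
  (∃ λ A → P A ≡ true) → (∃ λ B → Q B ≡ true) → CIBound n k s (cnt P) (cnt Q)

CIBound-swap : ∀ {n k s} p q → CIBound n k s p q → CIBound n k s q p
CIBound-swap p q (b , e) rewrite +-comm p q = b , λ h₁ h₂ h₃ → Sum.swap (e h₁ h₂ h₃)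

-- Here `z` is the surplus binomial, and `U` already contains one of the two summands 1 that arise
-- when two section bounds are added.
slack : ∀ {T U z} → T + z ≤ U + 1 → 1 ≤ z → T ≤ U
slack {T} {U} h 1≤z = +-cancelʳ-≤ 1 T U (≤-trans (+-monoʳ-≤ T 1≤z) h)

slack-strict : ∀ {T U z} → T + z ≤ U + 1 → 2 ≤ z → U ≤ T → ⊥
slack-strict {T} {U} {z} h 2≤z U≤T with +-cancelˡ-≤ U 2 1 (≤-trans (+-mono-≤ U≤T 2≤z) h)
... | s≤s ()

cross-sym : {P Q : Family n} → Cross P Q → Cross Q P
cross-sym c A B q p = trans (meets-comm A B) (c B A p q)

-- On `k + k` points the complement of a member of `Q` is again a `k`-set, and it misses that
-- member, so it is not in `P`.
cross-middle : ∀ k → {P Q : Family (k + k)} → Uniform k P → Uniform k Q → Cross P Q →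
  cnt P + cnt Q ≤ bin (k + k) k
cross-middle k {P} {Q} u v c = begin
  cnt P + cnt Q             ≡⟨ cong (cnt P +_) (cnt-complement Q) ⟨
  cnt P + cnt (Q ∘ map not) ≤⟨ cnt-disjoint P (Q ∘ map not) (λ A → wt A ≡ᵇ k)
    (λ A p q → true≢false (c A (map not A) p q) (meets-complement A))
    (λ A p → ≡ᵇ-complete (u A p))
    (λ A q → ≡ᵇ-complete (+-cancelˡ-≡ k _ _ (trans (cong (_+ wt A) (sym (v _ q))) (wt-complement A)))) ⟩
  cnt {k + k} (λ A → wt A ≡ᵇ k) ≡⟨ cnt-wt (k + k) k ⟩
  bin (k + k) k             ∎
  where open ≤-Reasoning

-- If every (k - 1)-set meeting B survives in the head section of P, a second set of Q would miss one of them.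
cross-empty-section : ∀ k r → n ≡ suc k + r → suc k ≤ r → (P Q : Family (suc n)) →
  Uniform (suc k) P → Uniform (suc k) Q → Cross P Q →
  (∃ λ B → Q (false ∷ B) ≡ true) → (∀ B → Q (true ∷ B) ≡ false) →
  cnt (P ∘ (false ∷_)) + cnt (Q ∘ (false ∷_)) + bin r (suc k) ≤ bin n (suc k) + 1 →
  CIBound (suc n) (suc k) (suc r) (cnt P) (cnt Q)
cross-empty-section {n} k r n≡ k<r P Q u v c (B , B∈Q) Q₁-empty ih =
  bound₁ , λ { (s≤s 2≤k) _ tight → inj₂ (cnt≤1 Q (unique 2≤k tight)) }
  where
  p₀ = cnt (P ∘ (false ∷_))
  p₁ = cnt (P ∘ (true ∷_))
  q₀ = cnt (Q ∘ (false ∷_))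
  wtB : wt B ≡ suc k
  wtB = v _ B∈Q
  B-size : wt B + r ≡ n
  B-size = trans (cong (_+ r) wtB) (sym n≡)
  u₁ : Uniform k (P ∘ (true ∷_))
  u₁ A p = suc-injective (u _ p)
  m₁ : ∀ A → P (true ∷ A) ≡ true → meets A B ≡ true
  m₁ A p = c _ _ p B∈Q
  q₁≡0 : cnt (Q ∘ (true ∷_)) ≡ 0
  q₁≡0 = cnt-empty _ Q₁-empty
  regroup : ∀ p₀ p₁ q₀ x y → p₀ + p₁ + (q₀ + 0) + (x + y) ≡ (p₁ + x) + (p₀ + q₀ + y)
  regroup = solve-∀
  total : cnt P + cnt Q + bin (suc r) (suc k) ≡ (p₁ + bin r k) + (p₀ + q₀ + bin r (suc k))
  total rewrite q₁≡0 = regroup p₀ p₁ q₀ (bin r k) (bin r (suc k))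
  bound₁ : cnt P + cnt Q + bin (suc r) (suc k) ≤ bin (suc n) (suc k) + 1
  bound₁ = begin
    cnt P + cnt Q + bin (suc r) (suc k)            ≡⟨ total ⟩
    (p₁ + bin r k) + (p₀ + q₀ + bin r (suc k))     ≤⟨ +-mono-≤ (cnt-meeting B r k B-size u₁ m₁) ih ⟩
    bin n k + (bin n (suc k) + 1)                  ≡⟨ +-assoc (bin n k) _ 1 ⟨
    bin (suc n) (suc k) + 1                        ∎
    where open ≤-Reasoning
  unique : 2 ≤ k → bin (suc n) (suc k) + 1 ≤ cnt P + cnt Q + bin (suc r) (suc k) → AtMostOne Q
  unique (s≤s (s≤s {n = j} z≤n)) tight {A′} {B′} a b = trans (is-B A′ a) (sym (is-B B′ b))
    where
    full : ∀ D → wt D ≡ k → meets D B ≡ true → P (true ∷ D) ≡ true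
    full = cnt-meeting-full B r k B-size u₁ m₁
      (proj₁ (+-split-≤ (cnt-meeting B r k B-size u₁ m₁) ih
        (≤-trans (≤-reflexive (sym (+-assoc (bin n k) _ 1))) (≤-trans tight (≤-reflexive total)))))
    is-B : ∀ C → Q C ≡ true → C ≡ false ∷ B
    is-B (true ∷ C)  q = ⊥-elim (true≢false q (Q₁-empty C))
    is-B (false ∷ C) q with equal-or-differ B C (≤-reflexive (trans (v _ q) (sym wtB)))
    ... | inj₁ refl = refl
    -- `C` has `k + 1` elements, so a `k`-set outside `C` needs `2k + 1 ≤ n`, which amounts to
    -- `k ≤ r`.
    ... | inj₂ (y , y∈B , y∉C) with fill-with C _ y y∉C
            (≤-trans (≤-reflexive (trans (cong (k +_) (v _ q)) (+-comm k _)))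
              (≤-trans (+-monoʳ-≤ (suc k) (<⇒≤ k<r)) (≤-reflexive (sym n≡))))
    ... | D , wD , miss , y∈D =
      ⊥-elim (true≢false (c _ _ (full D wD (meets-intro D B y y∈D y∈B)) q) miss)

-- The induction hypothesis applies to both pairs of sections. In the sum, Pascal's rule turns the
-- subtracted terms into `bin (suc r) (suc k)` and a surplus `bin r (k - 1)`. The surplus absorbs
-- the second summand 1 and excludes equality as soon as it is at least 2. For `k = 0` the upper
-- sections would consist of empty sets, which cannot meet.
cross-both-sections : CrossTheorem n → ∀ k r → n ≡ suc k + r → suc k ≤ r → (P Q : Family (suc n)) →
  Uniform (suc k) P → Uniform (suc k) Q → Cross P Q → Stable P →
  (∃ λ A → P (true ∷ A) ≡ true) → (∃ λ B → Q (true ∷ B) ≡ true) →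
  CIBound n (suc k) r (cnt (P ∘ (false ∷_))) (cnt (Q ∘ (false ∷_))) →
  CIBound (suc n) (suc k) (suc r) (cnt P) (cnt Q)
cross-both-sections {n} ih k r n≡ k<r P Q u v c stP (A , p) (B , q) ih₀ = by-weight k refl
  where
  k+k<n : k + k < n
  k+k<n = ≤-trans (+-monoʳ-≤ (suc k) (<⇒≤ k<r)) (≤-reflexive (sym n≡))
  c₁ : Cross (P ∘ (true ∷_)) (Q ∘ (true ∷_))
  c₁ = cross-section k+k<n u v stP c
  ih₁ = ih k (suc r) (trans n≡ (sym (+-suc k r))) (m≤n⇒m≤1+n (<⇒≤ k<r)) _ _
    (λ A p → suc-injective (u _ p)) (λ B q → suc-injective (v _ q)) c₁ (A , p) (B , q)
  p₀ = cnt (P ∘ (false ∷_))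
  p₁ = cnt (P ∘ (true ∷_))
  q₀ = cnt (Q ∘ (false ∷_))
  q₁ = cnt (Q ∘ (true ∷_))
  regroup : ∀ p₀ p₁ q₀ q₁ x y z → p₀ + p₁ + (q₀ + q₁) + (y + x) + z ≡ (p₀ + q₀ + x) + (p₁ + q₁ + (z + y))
  regroup = solve-∀
  regroup′ : ∀ X Y → X + 1 + (Y + 1) ≡ Y + X + 1 + 1
  regroup′ = solve-∀
  by-weight : ∀ k′ → k ≡ k′ → CIBound (suc n) (suc k) (suc r) (cnt P) (cnt Q)
  by-weight zero     refl = ⊥-elim (meets-wt0 A B (suc-injective (u _ p)) (c₁ A B p q))
  by-weight (suc k′) refl =
    slack key (bin≥1 (≤-trans (n≤1+n k′) (<⇒≤ k<r))) ,
    λ { (s≤s (s≤s 1≤k′)) _ tight → ⊥-elim (slack-strict key (bin≥2 1≤k′ (<⇒≤ k<r)) tight) }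
    where
    key : cnt P + cnt Q + bin (suc r) (suc (suc k′)) + bin r k′ ≤ bin (suc n) (suc (suc k′)) + 1 + 1
    key = begin
      cnt P + cnt Q + bin (suc r) (suc (suc k′)) + bin r k′
        ≡⟨ regroup p₀ p₁ q₀ q₁ (bin r (suc (suc k′))) (bin r (suc k′)) (bin r k′) ⟩
      (p₀ + q₀ + bin r (suc (suc k′))) + (p₁ + q₁ + bin (suc r) (suc k′))
        ≤⟨ +-mono-≤ (proj₁ ih₀) (proj₁ ih₁) ⟩
      bin n (suc (suc k′)) + 1 + (bin n (suc k′) + 1)
        ≡⟨ regroup′ (bin n (suc (suc k′))) (bin n (suc k′)) ⟩
      bin (suc n) (suc (suc k′)) + 1 + 1 ∎
      where open ≤-Reasoning

-- Stability makes both lower sections nonempty, so the induction hypothesis always applies to them,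
-- and only the upper sections need a case distinction.
cross-stable : CrossTheorem n → ∀ k r → n ≡ suc k + r → suc k ≤ r → (P Q : Family (suc n)) →
  Uniform (suc k) P → Uniform (suc k) Q → Cross P Q → Stable P → Stable Q →
  (∃ λ A → P A ≡ true) → (∃ λ B → Q B ≡ true) → CIBound (suc n) (suc k) (suc r) (cnt P) (cnt Q)
cross-stable {n} ih k r n≡ k<r P Q u v c stP stQ neP neQ
  with search (P ∘ (true ∷_)) | search (Q ∘ (true ∷_))
... | s₁ | s₂ = by-cases s₁ s₂
  where
  k+1<n+1 : suc k < suc n
  k+1<n+1 = s≤s (≤-trans (m≤m+n (suc k) r) (≤-reflexive (sym n≡)))
  neP₀ = stable-section-nonempty k+1<n+1 u stP neP
  neQ₀ = stable-section-nonempty k+1<n+1 v stQ neQ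
  ih₀ : CIBound n (suc k) r (cnt (P ∘ (false ∷_))) (cnt (Q ∘ (false ∷_)))
  ih₀ = ih (suc k) r n≡ k<r _ _ (λ A → u _) (λ A → v _) (λ A B → c _ _) neP₀ neQ₀
  by-cases : (∀ A → P (true ∷ A) ≡ false) ⊎ (∃ λ A → P (true ∷ A) ≡ true) →
             (∀ A → Q (true ∷ A) ≡ false) ⊎ (∃ λ A → Q (true ∷ A) ≡ true) →
             CIBound (suc n) (suc k) (suc r) (cnt P) (cnt Q)
  by-cases _         (inj₁ e)  = cross-empty-section k r n≡ k<r P Q u v c neQ₀ e (proj₁ ih₀)
  by-cases (inj₁ e)  (inj₂ _)  = CIBound-swap {suc n} {suc k} {suc r} (cnt Q) (cnt P)
    (cross-empty-section k r n≡ k<r Q P v u (cross-sym c) neP₀ e (proj₁ (CIBound-swap {n} {suc k} {r} _ _ ih₀)))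
  by-cases (inj₂ ne) (inj₂ ne′) = cross-both-sections ih k r n≡ k<r P Q u v c stP ne ne′ ih₀

-- Both families undergo the same shift, so that they stay cross-intersecting. The measure is the
-- sum of the two head sections, which decreases even if only one of the families is unstable.
cross-shift : CrossTheorem (suc n) → ∀ k r → suc n ≡ suc k + r → suc k ≤ r → (P Q : Family (2 + n)) →
  Uniform (suc k) P → Uniform (suc k) Q → Cross P Q →
  (∃ λ A → P A ≡ true) → (∃ λ B → Q B ≡ true) →
  Acc _<_ (cnt (P ∘ (true ∷_)) + cnt (Q ∘ (true ∷_))) →
  CIBound (2 + n) (suc k) (suc r) (cnt P) (cnt Q)
cross-shift ih k r n≡ k<r P Q u v c neP neQ (acc rec) with stable? P | stable? Q
... | inj₁ stP | inj₁ stQ = cross-stable ih k r n≡ k<r P Q u v c stP stQ neP neQ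
... | inj₂ (i , b) | _ =
  subst₂ (CIBound _ (suc k) (suc r)) (cnt-compress-move P i) (cnt-compress-move Q i)
    (cross-shift ih k r n≡ k<r _ _ (uniform-compress (uniform-move i u)) (uniform-compress (uniform-move i v))
      (cross-compress (cross-move i c)) (compress-nonempty (nonempty-move i neP)) (compress-nonempty (nonempty-move i neQ))
      (rec (+-mono-<-≤ (compress-decreases P i b) (compress-nonincreasing Q i))))
... | inj₁ _ | inj₂ (i , b) =
  subst₂ (CIBound _ (suc k) (suc r)) (cnt-compress-move P i) (cnt-compress-move Q i)
    (cross-shift ih k r n≡ k<r _ _ (uniform-compress (uniform-move i u)) (uniform-compress (uniform-move i v))
      (cross-compress (cross-move i c)) (compress-nonempty (nonempty-move i neP)) (compress-nonempty (nonempty-move i neQ))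
      (rec (+-mono-≤-< (compress-nonincreasing P i) (compress-decreases Q i b))))

cross-theorem : ∀ n → CrossTheorem n
cross-theorem n zero s n≡ k≤s P Q u v c (A , p) (B , q) = ⊥-elim (meets-wt0 A B (u A p) (c A B p q))
cross-theorem n (suc k) s n≡ k<s P Q u v c neP neQ with m≤n⇒m<n∨m≡n k<s
-- On `2k` points the subtracted binomial is `bin k k = 1` and cancels the summand 1. The equality
-- clause is void, as it asks for `k < s`.
cross-theorem _ (suc k) _ refl k<s P Q u v c neP neQ | inj₂ refl =
  ≤-trans (≤-reflexive (cong (cnt P + cnt Q +_) (bin-diag (suc k)))) (+-monoˡ-≤ 1 (cross-middle (suc k) u v c)) ,
  λ _ k<k → contradiction k<k (<-irrefl refl)
cross-theorem (suc (suc n)) (suc k) (suc r) n≡ k<s P Q u v c neP neQ | inj₁ (s≤s k<r) =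
  cross-shift (cross-theorem (suc n)) k r (suc-injective (trans n≡ (cong suc (+-suc k r)))) k<r P Q u v c neP neQ (<-wellFounded _)
cross-theorem (suc zero) (suc k) (suc r) n≡ k<s P Q u v c neP neQ | inj₁ (s≤s k<r)
  with () ← trans (suc-injective n≡) (+-suc k r)

-- Nontrivial intersecting families

Nontrivial : Family n → Set
Nontrivial {n} P = ∀ (x : Fin n) → ∃ λ A → P A ≡ true × lookup A x ≡ false

avoiding : Fin n → Family n → Family n
avoiding x P A = P A ∧ not (lookup A x)

-- The information about equality that is carried through the induction. It is phrased as a count
-- because compression preserves counts.
Lone : Fin n → Family n → Set
Lone x P = cnt (avoiding x P) ≤ 1

cnt-avoiding : (x : Fin (suc n)) (P : Family (suc n)) → cnt (avoiding x P) ≡ cnt (λ R → P (insertAt R x false))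
cnt-avoiding x P = begin
  cnt (avoiding x P) ≡⟨ cnt-insert (avoiding x P) x ⟩
  cnt (λ R → avoiding x P (insertAt R x false)) + cnt (λ R → avoiding x P (insertAt R x true))
    ≡⟨ cong₂ _+_ (cnt-cong absent) (cnt-empty _ present) ⟩
  cnt (λ R → P (insertAt R x false)) + 0 ≡⟨ +-identityʳ _ ⟩
  cnt (λ R → P (insertAt R x false)) ∎
  where
  open ≡-Reasoning
  absent : ∀ R → avoiding x P (insertAt R x false) ≡ P (insertAt R x false)
  absent R rewrite insertAt-lookup R x false = ∧-identityʳ _
  present : ∀ R → avoiding x P (insertAt R x true) ≡ false
  present R rewrite insertAt-lookup R x true = ∧-zeroʳ _

-- The sets have size k = j + 1 and the number of points is n + 1 = k + s + 1.
HMBound : (j s : ℕ) → Family (suc n) → Set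
HMBound {n} j s P =
  (cnt P + bin s j ≤ bin n j + 1) × (3 ≤ j → j < s → bin n j + 1 ≤ cnt P + bin s j → ∃ λ x → Lone x P)

HMTheorem : ℕ → Set
HMTheorem n = ∀ j s → n ≡ suc j + s → j ≤ s → (P : Family (suc n)) → Uniform (suc j) P → Cross P P → Nontrivial P → HMBound j s P

section-of-member : {P : Family (suc n)} (x : Fin (suc n)) (b : Bool) → ∀ {A} → P A ≡ true → lookup A x ≡ b →
  P (insertAt (removeAt A x) x b) ≡ true
section-of-member {P = P} x b {A} p l = trans (cong P (insertAt-removeAt-at A x l)) p

wt-section : ∀ {k} {P : Family (suc n)} → Uniform k P → (x : Fin (suc n)) (b : Bool) → ∀ R →
  P (insertAt R x b) ≡ true → b2n b + wt R ≡ k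
wt-section u x b R p = trans (sym (wt-insert R x b)) (u _ p)

-- All members but one contain `x`, and they meet the exceptional set `Y` outside `x`. Nontriviality
-- provides `Y`, which leaves `s` of the other `n` points.
lone-bound : ∀ {j s} → n ≡ suc j + s → (P : Family (suc n)) → Uniform (suc j) P → Cross P P → Nontrivial P →
  (x : Fin (suc n)) → Lone x P → HMBound j s P
lone-bound {n} {j} {s} n≡ P u c nt x lone = upper , λ _ _ _ → x , lone
  where
  Y = removeAt (proj₁ (nt x)) x
  Y∈P : P (insertAt Y x false) ≡ true
  Y∈P = section-of-member {P = P} x false (proj₁ (proj₂ (nt x))) (proj₂ (proj₂ (nt x)))
  a = cnt (λ R → P (insertAt R x false))
  b = cnt (λ R → P (insertAt R x true))
  meeting : b + bin s j ≤ bin n j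
  meeting = cnt-meeting Y s j (trans (cong (_+ s) (wt-section u x false Y Y∈P)) (sym n≡))
    (λ R p → suc-injective (wt-section u x true R p))
    (λ R p → trans (sym (meets-insert R Y x true false)) (c _ _ p Y∈P))
  upper : cnt P + bin s j ≤ bin n j + 1
  upper = begin
    cnt P + bin s j     ≡⟨ cong (_+ bin s j) (cnt-insert P x) ⟩
    a + b + bin s j     ≡⟨ +-assoc a b _ ⟩
    a + (b + bin s j)   ≤⟨ +-mono-≤ (≤-trans (≤-reflexive (sym (cnt-avoiding x P))) lone) meeting ⟩
    1 + bin n j         ≡⟨ +-comm 1 _ ⟩
    bin n j + 1         ∎
    where open ≤-Reasoning

module Quarters {n i r : ℕ} (n≡ : n ≡ suc i + suc r) (i<r : suc i ≤ r)
  (P : Family (2 + n)) (u : Uniform (suc (suc i)) P) (c : Cross P P) (nt : Nontrivial P)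
  (few : cnt (λ R → P (false ∷ false ∷ R)) ≤ 1) where

  p₀₀ = cnt (λ R → P (false ∷ false ∷ R))
  p₀₁ = cnt (λ R → P (false ∷ true ∷ R))
  p₁₀ = cnt (λ R → P (true ∷ false ∷ R))
  p₁₁ = cnt (λ R → P (true ∷ true ∷ R))

  lone₀ : p₀₀ + p₀₁ ≤ 1 → Lone zero P
  lone₀ = ≤-trans (≤-reflexive (cnt-avoiding zero P))

  lone₁ : p₀₀ + p₁₀ ≤ 1 → Lone (suc zero) P
  lone₁ = ≤-trans (≤-reflexive (cnt-avoiding (suc zero) P))

  from-lone : (x : Fin (2 + n)) → Lone x P → HMBound (suc i) (suc r) P
  from-lone = lone-bound (cong suc n≡) P u c nt

  regroup : ∀ a b c d x → a + b + (c + d) + x ≡ (a + d) + (b + c + x)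
  regroup = solve-∀

  -- Every member meets the first two points. Those containing both are bounded trivially, those
  -- containing exactly one form a cross-intersecting pair, and the two bounds add up by Pascal's
  -- rule. In the case of equality one half of the pair has at most one set, and this set is then
  -- the only possible member missing the corresponding point.
  two-cover : p₀₀ ≡ 0 → CIBound n (suc i) (suc r) p₀₁ p₁₀ → HMBound (suc i) (suc r) P
  two-cover p₀₀≡0 (ci , ci-tight) =
    ≤-trans (≤-reflexive total) (≤-trans (+-mono-≤ p₁₁≤ ci) (≤-reflexive (sym (+-assoc (bin n i) _ 1)))) , tight
    where
    p₁₁≤ : p₁₁ ≤ bin n i
    p₁₁≤ = uniform⇒cnt≤bin λ A p → suc-injective (suc-injective (u _ p))
    total : cnt P + bin (suc r) (suc i) ≡ p₁₁ + (p₀₁ + p₁₀ + bin (suc r) (suc i))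
    total = trans (regroup p₀₀ p₀₁ p₁₀ p₁₁ (bin (suc r) (suc i)))
                  (cong (λ z → z + p₁₁ + (p₀₁ + p₁₀ + bin (suc r) (suc i))) p₀₀≡0)
    tight : 3 ≤ suc i → suc i < suc r → bin (suc n) (suc i) + 1 ≤ cnt P + bin (suc r) (suc i) → ∃ λ x → Lone x P
    tight h₁ h₂ h₃ with ci-tight h₁ h₂ (proj₂ (+-split-≤ p₁₁≤ ci
      (≤-trans (≤-reflexive (sym (+-assoc (bin n i) _ 1))) (≤-trans h₃ (≤-reflexive total)))))
    ... | inj₁ p₀₁≤1 = zero , lone₀ (≤-trans (≤-reflexive (cong (_+ p₀₁) p₀₀≡0)) p₀₁≤1)
    ... | inj₂ p₁₀≤1 = suc zero , lone₁ (≤-trans (≤-reflexive (cong (_+ p₁₀) p₀₀≡0)) p₁₀≤1)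

  -- The set `Y` costs 1, but every member containing both points must meet it, which saves
  -- `bin r i`. This pays for `Y`, and more than pays in the equality range.
  one-exception : (Y : Vec Bool n) → P (false ∷ false ∷ Y) ≡ true → CIBound n (suc i) (suc r) p₀₁ p₁₀ →
    HMBound (suc i) (suc r) P
  one-exception Y Y∈P (ci , _) =
    slack key (bin≥1 (≤-trans (n≤1+n i) i<r)) ,
    λ { (s≤s 2≤i) _ h → ⊥-elim (slack-strict key (bin≥2 (≤-trans (s≤s z≤n) 2≤i) i<r) h) }
    where
    p₁₁≤ : p₁₁ + bin r i ≤ bin n i
    p₁₁≤ = cnt-meeting Y r i (trans (cong (_+ r) (u _ Y∈P)) (trans (sym (+-suc (suc i) r)) (sym n≡)))
      (λ A p → suc-injective (suc-injective (u _ p))) (λ A p → c _ _ p Y∈P)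
    regroup′ : ∀ a b c d x y → a + b + (c + d) + x + y ≡ a + (d + y) + (b + c + x)
    regroup′ = solve-∀
    regroup″ : ∀ X Y → 1 + X + (Y + 1) ≡ X + Y + 1 + 1
    regroup″ = solve-∀
    key : cnt P + bin (suc r) (suc i) + bin r i ≤ bin (suc n) (suc i) + 1 + 1
    key = begin
      cnt P + bin (suc r) (suc i) + bin r i ≡⟨ regroup′ p₀₀ p₀₁ p₁₀ p₁₁ (bin (suc r) (suc i)) (bin r i) ⟩
      p₀₀ + (p₁₁ + bin r i) + (p₀₁ + p₁₀ + bin (suc r) (suc i)) ≤⟨ +-mono-≤ (+-mono-≤ few p₁₁≤) ci ⟩
      1 + bin n i + (bin n (suc i) + 1) ≡⟨ regroup″ (bin n i) (bin n (suc i)) ⟩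
      bin (suc n) (suc i) + 1 + 1 ∎
      where open ≤-Reasoning

  -- The cross-intersection bound needs both halves nonempty. If one is empty, all members missing
  -- the corresponding point miss both, and by `few` that point is lone.
  quarters-bound : HMBound (suc i) (suc r) P
  quarters-bound with search (λ R → P (false ∷ true ∷ R)) | search (λ R → P (true ∷ false ∷ R)) | search (λ R → P (false ∷ false ∷ R))
  ... | inj₁ e | _ | _ =
    from-lone zero (lone₀ (≤-trans (≤-reflexive (trans (cong (p₀₀ +_) (cnt-empty _ e)) (+-identityʳ p₀₀))) few))
  ... | inj₂ _ | inj₁ e | _ =
    from-lone (suc zero) (lone₁ (≤-trans (≤-reflexive (trans (cong (p₀₀ +_) (cnt-empty _ e)) (+-identityʳ p₀₀))) few))
  ... | inj₂ ne | inj₂ ne′ | s = finish s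
    where
    ci : CIBound n (suc i) (suc r) p₀₁ p₁₀
    ci = cross-theorem n (suc i) (suc r) n≡ (m≤n⇒m≤1+n i<r) _ _
      (λ A p → suc-injective (u _ p)) (λ A p → suc-injective (u _ p)) (λ A B p q → c _ _ p q) ne ne′
    finish : (∀ R → P (false ∷ false ∷ R) ≡ false) ⊎ (∃ λ R → P (false ∷ false ∷ R) ≡ true) → HMBound (suc i) (suc r) P
    finish (inj₁ e)       = two-cover (cnt-empty _ e) ci
    finish (inj₂ (Y , p)) = one-exception Y p ci

-- Shifting nontrivial families

nontrivial-move : {P : Family (2 + n)} (i : Fin (suc n)) → Nontrivial P → Nontrivial (P ∘ move i)
nontrivial-move {P = P} i nt x =
  let A , p , f = nt (move-index i x)
  in unmove i A , trans (cong P (move-unmove i A)) p ,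
     trans (sym (lookup-move i (unmove i A) x)) (trans (cong (λ A → lookup A (move-index i x)) (move-unmove i A)) f)

lone-move : {P : Family (2 + n)} (i : Fin (suc n)) (x : Fin (2 + n)) → Lone x (P ∘ move i) → Lone (move-index i x) P
lone-move {P = P} i x = ≤-trans (≤-reflexive (sym (trans
  (cnt-cong λ A → cong (λ b → P (move i A) ∧ not b) (sym (lookup-move i A x)))
  (cnt-move i (avoiding (move-index i x) P)))))

hmbound-move : ∀ {j s} {P : Family (2 + n)} (i : Fin (suc n)) → HMBound j s (P ∘ move i) → HMBound j s P
hmbound-move {P = P} i (b , t) rewrite cnt-move i P =
  b , λ h₁ h₂ h₃ → let x , l = t h₁ h₂ h₃ in move-index i x , lone-move {P = P} i x l

-- The shift acts on the first two points only, so it commutes with selecting the members that miss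
-- a later point and preserves their number.
lone-compress : (P : Family (2 + n)) (x : Fin n) → Lone (suc (suc x)) (compress P) → Lone (suc (suc x)) P
lone-compress P x = ≤-trans (≤-reflexive (trans (sym (cnt-compress (avoiding (suc (suc x)) P))) (cnt-cong commutes)))
  where
  ∧-distrib : ∀ a b c → (a ∧ c) ∧ (b ∧ c) ≡ (a ∧ b) ∧ c
  ∧-distrib true  true  true  = refl
  ∧-distrib true  true  false = refl
  ∧-distrib true  false c     = ∧-zeroʳ c
  ∧-distrib false b     c     = refl
  commutes : ∀ A → compress (avoiding (suc (suc x)) P) A ≡ avoiding (suc (suc x)) (compress P) A
  commutes (false ∷ false ∷ R) = refl
  commutes (false ∷ true ∷ R)  = sym (∧-distribʳ-∨ (not (lookup R x)) (P (false ∷ true ∷ R)) _)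
  commutes (true ∷ false ∷ R)  = ∧-distrib (P (false ∷ true ∷ R)) (P (true ∷ false ∷ R)) (not (lookup R x))
  commutes (true ∷ true ∷ R)   = refl

nontrivial? : (P : Family n) → Nontrivial P ⊎ ∃ λ x → ∀ A → P A ≡ true → lookup A x ≡ true
nontrivial? P = all-or-some step
  where
  step : ∀ x → (∃ λ A → P A ≡ true × lookup A x ≡ false) ⊎ (∀ A → P A ≡ true → lookup A x ≡ true)
  step x with search (avoiding x P)
  ... | inj₂ (A , t) = inj₁ (A , proj₁ (∧-elim t) , not-false (proj₂ (∧-elim {P A} t)))
  ... | inj₁ e       = inj₂ common
    where
    common : ∀ A → P A ≡ true → lookup A x ≡ true
    common A p with e A
    ... | b rewrite p with lookup A x | b
    ... | true | _ = refl

-- A later point cannot become common, since a member missing it still has an image missing it. So a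
-- common point is one of the first two, and a member missing both of these would be left unchanged
-- by the shift.
compress-common : {P : Family (2 + n)} → Nontrivial P → (x : Fin (2 + n)) →
  (∀ A → compress P A ≡ true → lookup A x ≡ true) → ∀ R → P (false ∷ false ∷ R) ≡ false
compress-common {P = P} nt zero com R with bool-cases (P (false ∷ false ∷ R))
... | inj₂ f = f
... | inj₁ t with () ← com (false ∷ false ∷ R) t
compress-common {P = P} nt (suc zero) com R with bool-cases (P (false ∷ false ∷ R))
... | inj₂ f = f
... | inj₁ t with () ← com (false ∷ false ∷ R) t
compress-common {P = P} nt (suc (suc x)) com R with nt (suc (suc x))
... | false ∷ false ∷ S , p , f = ⊥-elim (true≢false (com (false ∷ false ∷ S) p) f)
... | true ∷ true ∷ S , p , f   = ⊥-elim (true≢false (com (true ∷ true ∷ S) p) f)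
... | false ∷ true ∷ S , p , f  = ⊥-elim (true≢false (com (false ∷ true ∷ S) (cong (_∨ P (true ∷ false ∷ S)) p)) f)
... | true ∷ false ∷ S , p , f  = ⊥-elim (true≢false (com (false ∷ true ∷ S) (∨-introʳ (P (false ∷ true ∷ S)) p)) f)

-- Members missing both points are fixed by the shift, and each of them misses whichever of the two
-- points is lone.
lone-compress-early : (P : Family (2 + n)) → Lone zero (compress P) ⊎ Lone (suc zero) (compress P) →
  cnt (λ R → P (false ∷ false ∷ R)) ≤ 1
lone-compress-early P (inj₁ l) = ≤-trans (m≤m+n _ _) (≤-trans (≤-reflexive (sym (cnt-avoiding zero (compress P)))) l)
lone-compress-early P (inj₂ l) = ≤-trans (m≤m+n _ _) (≤-trans (≤-reflexive (sym (cnt-avoiding (suc zero) (compress P)))) l)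

-- Stable nontrivial families

set-false : (D : Vec Bool n) (x i : Fin n) → lookup (D [ x ]≔ true) i ≡ false → lookup D i ≡ false
set-false (d ∷ D) zero    (suc i) f = f
set-false (d ∷ D) (suc x) zero    f = f
set-false (d ∷ D) (suc x) (suc i) f = set-false D x i f

set-false-swap : (D : Vec Bool n) (x i : Fin n) → lookup D x ≡ false → lookup (D [ x ]≔ true) i ≡ false →
  lookup (D [ i ]≔ true) x ≡ false
set-false-swap (d ∷ D) zero    (suc i) e f = e
set-false-swap (d ∷ D) (suc x) zero    e f = e
set-false-swap (d ∷ D) (suc x) (suc i) e f = set-false-swap D x i e f

-- A member that contains the head and misses `x` may exchange the head for another point `i`.
-- Setting `x` in `D` before the search keeps `i` different from `x`.
stable-section-nontrivial : ∀ {j} {P : Family (suc n)} → suc j < n → Uniform (suc j) P → Stable P → Nontrivial P →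
  Nontrivial (P ∘ (false ∷_))
stable-section-nontrivial h u st nt x with nt (suc x)
... | false ∷ A , p , f = A , p , f
... | true ∷ D , p , f with missing-element (D [ x ]≔ true)
        (≤-trans (≤-reflexive (cong suc (trans (wt-add D x f) (u _ p)))) h)
... | i , g = D [ i ]≔ true , st D i p (set-false D x i g) , set-false-swap D x i f g

wt1-unique : (A : Vec Bool n) (x y : Fin n) → wt A ≡ 1 → lookup A x ≡ true → lookup A y ≡ true → x ≡ y
wt1-unique (true ∷ A)  zero    zero    w a b = refl
wt1-unique (true ∷ A)  zero    (suc y) w a b = ⊥-elim (lookup-wt0 A y (suc-injective w) b)
wt1-unique (true ∷ A)  (suc x) y       w a b = ⊥-elim (lookup-wt0 A x (suc-injective w) a)
wt1-unique (false ∷ A) (suc x) (suc y) w a b = cong suc (wt1-unique A x y w a b)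

wt1-trivial : {P : Family n} → Cross P P → Nontrivial P → ∀ A → P A ≡ true → wt A ≡ 1 → ⊥
wt1-trivial c nt A p w =
  let x , x∈A , _   = meets-elim A A (c A A p p)
      B , q , x∉B   = nt x
      y , y∈A , y∈B = meets-elim A B (c A B p q)
  in true≢false y∈B (trans (cong (lookup B) (wt1-unique A y x w y∈A x∈A)) x∉B)

-- Without the centre `x`, the upper section consists of `i`-sets that all meet `Y`, which comes
-- from a member missing both the head and `x`. This count carries no summand 1, so Pascal's rule
-- gives the bound exactly. In the case of equality the star contains all such sets, and a second
-- member missing `x` would be disjoint from one of them.
hm-star-section : ∀ i r → n ≡ suc (suc i) + r → suc i ≤ r → (P : Family (2 + n)) →
  Uniform (suc (suc i)) P → Cross P P → Nontrivial (P ∘ (false ∷_)) →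
  HMBound (suc i) r (P ∘ (false ∷_)) →
  (x : Fin (suc n)) → (∀ D → P (true ∷ D) ≡ true → lookup D x ≡ true) → HMBound (suc i) (suc r) P
hm-star-section {n} i r n≡ i<r P u c nt₀ (ih , _) x com = bound₁ , tight
  where
  Y = removeAt (proj₁ (nt₀ x)) x
  Y∈P : P (false ∷ insertAt Y x false) ≡ true
  Y∈P = section-of-member {P = P ∘ (false ∷_)} x false (proj₁ (proj₂ (nt₀ x))) (proj₂ (proj₂ (nt₀ x)))
  u₀ : Uniform (suc (suc i)) (P ∘ (false ∷_))
  u₀ A p = u _ p
  u₁ : Uniform (suc i) (P ∘ (true ∷_))
  u₁ A p = suc-injective (u _ p)
  S : Family n
  S R = P (true ∷ insertAt R x true)
  p₀ = cnt (P ∘ (false ∷_))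
  p₁≡ : cnt (P ∘ (true ∷_)) ≡ cnt S
  p₁≡ = trans (cnt-insert (P ∘ (true ∷_)) x) (cong (_+ cnt S) (cnt-empty _ none))
    where
    none : ∀ R → P (true ∷ insertAt R x false) ≡ false
    none R with bool-cases (P (true ∷ insertAt R x false))
    ... | inj₂ f = f
    ... | inj₁ t = ⊥-elim (true≢false (com _ t) (insertAt-lookup R x false))
  uS : Uniform i S
  uS R p = suc-injective (wt-section u₁ x true R p)
  mS : ∀ R → S R ≡ true → meets R Y ≡ true
  mS R p = trans (sym (meets-insert R Y x true false)) (c _ _ p Y∈P)
  wtY : wt Y ≡ suc (suc i)
  wtY = wt-section u₀ x false Y Y∈P
  Y-size : wt Y + r ≡ n
  Y-size = trans (cong (_+ r) wtY) (sym n≡)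
  S≤ : cnt S + bin r i ≤ bin n i
  S≤ = cnt-meeting Y r i Y-size uS mS
  regroup : ∀ p s x y → p + s + (x + y) ≡ (s + x) + (p + y)
  regroup = solve-∀
  total : cnt P + bin (suc r) (suc i) ≡ (cnt S + bin r i) + (p₀ + bin r (suc i))
  total = trans (cong (λ z → p₀ + z + bin (suc r) (suc i)) p₁≡) (regroup p₀ (cnt S) (bin r i) (bin r (suc i)))
  bound₁ : cnt P + bin (suc r) (suc i) ≤ bin (suc n) (suc i) + 1
  bound₁ = ≤-trans (≤-reflexive total) (≤-trans (+-mono-≤ S≤ ih) (≤-reflexive (sym (+-assoc (bin n i) _ 1))))
  tight : 3 ≤ suc i → suc i < suc r → bin (suc n) (suc i) + 1 ≤ cnt P + bin (suc r) (suc i) → ∃ λ x → Lone x P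
  tight (s≤s (s≤s {n = i′} _)) _ h = suc x , cnt≤1 (avoiding (suc x) P) λ {A} {B} a b → trans (is-Y A a) (sym (is-Y B b))
    where
    full : ∀ R → wt R ≡ i → meets R Y ≡ true → S R ≡ true
    full = cnt-meeting-full Y r i Y-size uS mS
      (proj₁ (+-split-≤ S≤ ih (≤-trans (≤-reflexive (sym (+-assoc (bin n i) _ 1))) (≤-trans h (≤-reflexive total)))))
    is-Y : ∀ C → avoiding (suc x) P C ≡ true → C ≡ false ∷ insertAt Y x false
    is-Y (true ∷ C) t = let p , f = ∧-elim t in ⊥-elim (true≢false (com C p) (not-false f))
    is-Y (false ∷ C) t = by-difference (equal-or-differ Y C′ (≤-reflexive (trans wtC′ (sym wtY))))
      where
      C′ = removeAt C x
      x∉C : lookup C x ≡ false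
      x∉C = not-false (proj₂ (∧-elim {P (false ∷ C)} t))
      C∈P : P (false ∷ insertAt C′ x false) ≡ true
      C∈P = section-of-member {P = P ∘ (false ∷_)} x false (proj₁ (∧-elim t)) x∉C
      wtC′ : wt C′ ≡ suc (suc i)
      wtC′ = wt-section u₀ x false C′ C∈P
      room : i + wt C′ ≤ n
      room = ≤-trans (≤-reflexive (trans (cong (i +_) wtC′) (+-comm i _)))
        (≤-trans (+-monoʳ-≤ (suc (suc i)) (<⇒≤ i<r)) (≤-reflexive (sym n≡)))
      by-difference : Y ≡ C′ ⊎ (∃ λ y → lookup Y y ≡ true × lookup C′ y ≡ false) → false ∷ C ≡ false ∷ insertAt Y x false
      by-difference (inj₁ e) = cong (false ∷_) (trans (sym (insertAt-removeAt-at C x x∉C)) (cong (λ Z → insertAt Z x false) (sym e)))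
      by-difference (inj₂ (y , y∈Y , y∉C)) with fill-with C′ i′ y y∉C room
      ... | R , wR , miss , y∈R =
        ⊥-elim (true≢false (trans (sym (meets-insert R C′ x true false)) (c _ _ (full R wR (meets-intro R Y y y∈R y∈Y)) C∈P)) miss)

-- If both sections are nontrivial, the sum carries the summand 1 twice. The surplus `bin r i′` pays
-- for one of them and is at least 2 in the equality range, so equality can come only from the star
-- branch.
hm-stable : HMTheorem n → ∀ i r → n ≡ suc (suc i) + r → suc i ≤ r → (P : Family (2 + n)) →
  Uniform (suc (suc i)) P → Cross P P → Nontrivial P → Stable P → HMBound (suc i) (suc r) P
hm-stable {n} ih i r n≡ i<r P u c nt st with nontrivial? (P ∘ (true ∷_))
... | inj₂ (x , com) = hm-star-section i r n≡ i<r P u c nt₀ ih₀ x com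
  where
  nt₀ = stable-section-nontrivial (s≤s (≤-trans (m≤m+n _ r) (≤-reflexive (sym n≡)))) u st nt
  ih₀ = ih (suc i) r n≡ i<r (P ∘ (false ∷_)) (λ A → u _) (λ A B → c _ _) nt₀
... | inj₁ nt₁ = by-weight i refl
  where
  nt₀ = stable-section-nontrivial (s≤s (≤-trans (m≤m+n _ r) (≤-reflexive (sym n≡)))) u st nt
  ih₀ = ih (suc i) r n≡ i<r (P ∘ (false ∷_)) (λ A → u _) (λ A B → c _ _) nt₀
  c₁ : Cross (P ∘ (true ∷_)) (P ∘ (true ∷_))
  c₁ = cross-section (s≤s (≤-trans (+-monoʳ-≤ (suc i) i<r) (≤-trans (n≤1+n _) (≤-reflexive (sym n≡))))) u u st c
  u₁ : Uniform (suc i) (P ∘ (true ∷_))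
  u₁ A p = suc-injective (u _ p)
  ih₁ = ih i (suc r) (trans n≡ (sym (+-suc (suc i) r))) (m≤n⇒m≤1+n (<⇒≤ i<r)) (P ∘ (true ∷_)) u₁ c₁ nt₁
  p₀ = cnt (P ∘ (false ∷_))
  p₁ = cnt (P ∘ (true ∷_))
  regroup : ∀ p₀ p₁ x y z → p₀ + p₁ + (y + x) + z ≡ (p₀ + x) + (p₁ + (z + y))
  regroup = solve-∀
  regroup′ : ∀ X Y → X + 1 + (Y + 1) ≡ Y + X + 1 + 1
  regroup′ = solve-∀
  by-weight : ∀ i′ → i ≡ i′ → HMBound (suc i) (suc r) P
  by-weight zero refl = let A , p , _ = nt₁ zero in ⊥-elim (wt1-trivial c₁ nt₁ A p (u₁ A p))
  by-weight (suc i′) refl =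
    slack key (bin≥1 (≤-trans (n≤1+n i′) (<⇒≤ i<r))) ,
    λ { (s≤s (s≤s 1≤i′)) _ tight → ⊥-elim (slack-strict key (bin≥2 1≤i′ (<⇒≤ i<r)) tight) }
    where
    key : cnt P + bin (suc r) (suc (suc i′)) + bin r i′ ≤ bin (suc n) (suc (suc i′)) + 1 + 1
    key = begin
      cnt P + bin (suc r) (suc (suc i′)) + bin r i′
        ≡⟨ regroup p₀ p₁ (bin r (suc (suc i′))) (bin r (suc i′)) (bin r i′) ⟩
      (p₀ + bin r (suc (suc i′))) + (p₁ + bin (suc r) (suc i′))
        ≤⟨ +-mono-≤ (proj₁ ih₀) (proj₁ ih₁) ⟩
      bin n (suc (suc i′)) + 1 + (bin n (suc i′) + 1)
        ≡⟨ regroup′ (bin n (suc (suc i′))) (bin n (suc i′)) ⟩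
      bin (suc n) (suc (suc i′)) + 1 + 1 ∎
      where open ≤-Reasoning

-- Reduction to stable families and the Hilton-Milner theorem

hm-shift : HMTheorem n → ∀ i r → n ≡ suc (suc i) + r → suc i ≤ r → (P : Family (2 + n)) →
  Uniform (suc (suc i)) P → Cross P P → Nontrivial P → Acc _<_ (cnt (P ∘ (true ∷_))) → HMBound (suc i) (suc r) P
hm-shift {n} ih i r n≡ i<r P u c nt (acc rec) with stable? P
... | inj₁ st = hm-stable ih i r n≡ i<r P u c nt st
... | inj₂ (x , b) = hmbound-move {P = P} x (shifted (nontrivial? Q))
  where
  P′ = P ∘ move x
  Q = compress P′
  u′ : Uniform (suc (suc i)) P′
  u′ = uniform-move x u
  c′ : Cross P′ P′
  c′ = cross-move x c
  nt′ : Nontrivial P′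
  nt′ = nontrivial-move x nt
  quarters : cnt (λ R → P′ (false ∷ false ∷ R)) ≤ 1 → HMBound (suc i) (suc r) P′
  quarters = Quarters.quarters-bound (trans n≡ (sym (+-suc (suc i) r))) i<r P′ u′ c′ nt′
  shifted : Nontrivial Q ⊎ (∃ λ y → ∀ A → Q A ≡ true → lookup A y ≡ true) → HMBound (suc i) (suc r) P′
  -- If the shift creates a common point, no member of `P′` misses both shifted points, and `P′` is
  -- counted directly.
  shifted (inj₂ (y , com)) = quarters (≤-trans (≤-reflexive (cnt-empty _ (compress-common nt′ y com))) z≤n)
  shifted (inj₁ ntQ) = ≤-trans (≤-reflexive (cong (_+ bin (suc r) (suc i)) (sym (cnt-compress P′)))) (proj₁ hmQ) , tight
    where
    hmQ : HMBound (suc i) (suc r) Q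
    hmQ = hm-shift ih i r n≡ i<r Q (uniform-compress u′) (cross-compress c′) ntQ (rec (compress-decreases P x b))
    tight : 3 ≤ suc i → suc i < suc r → bin (suc n) (suc i) + 1 ≤ cnt P′ + bin (suc r) (suc i) → ∃ λ x → Lone x P′
    tight h₁ h₂ h₃ with proj₂ hmQ h₁ h₂ (≤-trans h₃ (≤-reflexive (cong (_+ bin (suc r) (suc i)) (sym (cnt-compress P′)))))
    -- A lone point among the two shifted ones is not transported back. It shows that at most one
    -- member of `P′` misses both, so the direct count supplies a lone point of `P′`.
    ... | zero        , l = proj₂ (quarters (lone-compress-early P′ (inj₁ l))) h₁ h₂ h₃
    ... | suc zero    , l = proj₂ (quarters (lone-compress-early P′ (inj₂ l))) h₁ h₂ h₃
    ... | suc (suc y) , l = suc (suc y) , lone-compress P′ y l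

-- Complements of members without the head contain the head and are not members. Hence they and the
-- upper section are disjoint collections, both counted by `j`-sets of the remaining points.
hm-middle : ∀ j (P : Family (2 + (j + j))) → Uniform (suc j) P → Cross P P → cnt P ≤ bin (suc (j + j)) j
hm-middle j P u c = begin
  p₀ + p₁                                 ≡⟨ cong (_+ p₁) (cnt-complement (P ∘ (false ∷_))) ⟨
  cnt (P ∘ (false ∷_) ∘ map not) + p₁     ≤⟨ cnt-disjoint (P ∘ (false ∷_) ∘ map not) (P ∘ (true ∷_)) (λ A → wt A ≡ᵇ j)
    (λ A p q → true≢false (c (true ∷ A) (false ∷ map not A) q p) (meets-complement A))
    (λ A p → ≡ᵇ-complete (+-cancelˡ-≡ (suc j) _ _ (trans (cong (_+ wt A) (sym (u _ p))) (wt-complement A))))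
    (λ A q → ≡ᵇ-complete (suc-injective (u _ q))) ⟩
  cnt {suc (j + j)} (λ A → wt A ≡ᵇ j)     ≡⟨ cnt-wt (suc (j + j)) j ⟩
  bin (suc (j + j)) j                     ∎
  where
  open ≤-Reasoning
  p₀ = cnt (P ∘ (false ∷_))
  p₁ = cnt (P ∘ (true ∷_))

hilton-milner : ∀ n → HMTheorem n
hilton-milner n zero s n≡ j≤s P u c nt = let A , p , _ = nt zero in ⊥-elim (wt1-trivial c nt A p (u A p))
hilton-milner n (suc j) s n≡ j≤s P u c nt with m≤n⇒m<n∨m≡n j≤s
hilton-milner _ (suc j) _ refl j≤s P u c nt | inj₂ refl =
  +-mono-≤ (hm-middle (suc j) P u c) (≤-reflexive (bin-diag (suc j))) ,
  λ _ j<j → contradiction j<j (<-irrefl refl)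
hilton-milner (suc n) (suc j) (suc r) n≡ j≤s P u c nt | inj₁ (s≤s j<r) =
  hm-shift (hilton-milner n) j r (suc-injective (trans n≡ (cong suc (+-suc (suc j) r)))) j<r P u c nt (<-wellFounded _)

-- Supports

positive : ℕ → Bool
positive zero    = false
positive (suc _) = true

positive⇒>0 : ∀ {a} → positive a ≡ true → 0 < a
positive⇒>0 {suc a} _ = s≤s z≤n

>0⇒positive : ∀ {a} → 0 < a → positive a ≡ true
>0⇒positive (s≤s _) = refl

supp : Multiset m → Vec Bool m
supp = map positive

∈-supp : (A : Multiset m) (i : Fin m) → 0 < mult i A → lookup (supp A) i ≡ true
∈-supp A i h = trans (lookup-map i positive A) (>0⇒positive h)

supp-∈ : (A : Multiset m) (i : Fin m) → lookup (supp A) i ≡ true → 0 < mult i A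
supp-∈ A i h = positive⇒>0 (trans (sym (lookup-map i positive A)) h)

∉-supp : (A : Multiset m) (i : Fin m) → mult i A ≡ 0 → lookup (supp A) i ≡ false
∉-supp A i h = trans (lookup-map i positive A) (cong positive h)

∩-intro : {A B : Multiset m} (i : Fin m) → 0 < mult i A → 0 < mult i B → NonEmpty (A ∩ B)
∩-intro {A = A} {B} i a b = i , subst (0 <_) (sym (lookup∘tabulate (λ i → mult i A ⊓ mult i B) i)) (⊓-pres-m< a b)

∩-elim : {A B : Multiset m} → NonEmpty (A ∩ B) → ∃ λ i → 0 < mult i A × 0 < mult i B
∩-elim {A = A} {B} (i , h) = i , m<n⊓o⇒m<n _ _ h′ , m<n⊓o⇒m<o _ _ h′
  where h′ = subst (0 <_) (lookup∘tabulate (λ i → mult i A ⊓ mult i B) i) h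

∩-sym : {A B : Multiset m} → NonEmpty (A ∩ B) → NonEmpty (B ∩ A)
∩-sym {A = A} {B} h = let i , a , b = ∩-elim {A = A} {B} h in ∩-intro {A = B} {A} i b a

supp-meets : {A B : Multiset m} → NonEmpty (A ∩ B) → meets (supp A) (supp B) ≡ true
supp-meets {A = A} {B} h =
  let i , a , b = ∩-elim {A = A} {B} h in meets-intro (supp A) (supp B) i (∈-supp A i a) (∈-supp B i b)

wt-supp≤card : (A : Multiset m) → wt (supp A) ≤ card A
wt-supp≤card []          = z≤n
wt-supp≤card (zero ∷ A)  = wt-supp≤card A
wt-supp≤card (suc a ∷ A) = s≤s (≤-trans (wt-supp≤card A) (m≤n+m _ a))

wt-supp≡card : (A : Multiset m) → wt (supp A) ≡ card A → ∀ i → mult i A ≡ b2n (lookup (supp A) i)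
wt-supp≡card (zero ∷ A)  e zero    = refl
wt-supp≡card (zero ∷ A)  e (suc i) = wt-supp≡card A e i
wt-supp≡card (suc zero ∷ A) e zero = refl
wt-supp≡card (suc zero ∷ A) e (suc i) = wt-supp≡card A (suc-injective e) i
wt-supp≡card (suc (suc a) ∷ A) e i =
  contradiction (≤-trans (≤-reflexive (sym (suc-injective e))) (wt-supp≤card A)) (λ h → 1+n≰n (≤-trans (s≤s (m≤n+m _ a)) h))

-- Encoding a multiset of size k by its support and a set of gaps

wtL : List Bool → ℕ
wtL []       = 0
wtL (b ∷ bs) = b2n b + wtL bs

pad : (n : ℕ) → List Bool → Vec Bool n
pad zero    _        = []
pad (suc n) []       = false ∷ pad n []
pad (suc n) (b ∷ bs) = b ∷ pad n bs

wt-pad : ∀ bs → length bs ≡ n → wt (pad n bs) ≡ wtL bs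
wt-pad []       refl = refl
wt-pad (b ∷ bs) refl = cong (b2n b +_) (wt-pad bs refl)

pad-injective : ∀ bs cs → length bs ≡ n → length cs ≡ n → pad n bs ≡ pad n cs → bs ≡ cs
pad-injective []       []       refl l e = refl
pad-injective (b ∷ bs) (c ∷ cs) refl l e with pad-injective bs cs refl (suc-injective l) (∷-injʳ e)
pad-injective (b ∷ bs) (.b ∷ bs) refl l refl | refl = refl

ones : ℕ → List Bool → List Bool
ones zero    bs = bs
ones (suc a) bs = true ∷ ones a bs

-- A positive multiplicity a becomes a marker false followed by a - 1 entries true.
gaps : Multiset m → List Bool
gaps []          = []
gaps (zero ∷ A)  = gaps A
gaps (suc a ∷ A) = false ∷ ones a (gaps A)

length-ones : ∀ a bs → length (ones a bs) ≡ a + length bs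
length-ones zero    bs = refl
length-ones (suc a) bs = cong suc (length-ones a bs)

wtL-ones : ∀ a bs → wtL (ones a bs) ≡ a + wtL bs
wtL-ones zero    bs = refl
wtL-ones (suc a) bs = cong suc (wtL-ones a bs)

length-gaps : (A : Multiset m) → length (gaps A) ≡ card A
length-gaps []          = refl
length-gaps (zero ∷ A)  = length-gaps A
length-gaps (suc a ∷ A) = cong suc (trans (length-ones a (gaps A)) (cong (a +_) (length-gaps A)))

wt-gaps : (A : Multiset m) → wt (supp A) + wtL (gaps A) ≡ card A
wt-gaps []          = refl
wt-gaps (zero ∷ A)  = wt-gaps A
wt-gaps (suc a ∷ A) = cong suc (trans (cong (wt (supp A) +_) (wtL-ones a (gaps A)))
  (trans (regroup (wt (supp A)) a (wtL (gaps A))) (cong (a +_) (wt-gaps A))))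
  where
  regroup : ∀ x y z → x + (y + z) ≡ y + (x + z)
  regroup = solve-∀

-- What follows a run of `true` entries is empty or starts with a marker, so the length of the run
-- can be read off.
data Marked : List Bool → Set where
  end  : Marked []
  mark : ∀ {bs} → Marked (false ∷ bs)

gaps-marked : (A : Multiset m) → Marked (gaps A)
gaps-marked []          = end
gaps-marked (zero ∷ A)  = gaps-marked A
gaps-marked (suc a ∷ A) = mark

ones-injective : ∀ a b {bs cs} → Marked bs → Marked cs → ones a bs ≡ ones b cs → a ≡ b × bs ≡ cs
ones-injective zero    zero    _  _    e  = refl , e
ones-injective zero    (suc b) end  _ ()
ones-injective zero    (suc b) mark _ ()
ones-injective (suc a) zero    _ end  ()
ones-injective (suc a) zero    _ mark ()
ones-injective (suc a) (suc b) p  q    e  =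
  let a≡b , r = ones-injective a b p q (List.∷-injectiveʳ e) in cong suc a≡b , r

gaps-injective : (A B : Multiset m) → supp A ≡ supp B → gaps A ≡ gaps B → A ≡ B
gaps-injective []          []          _ _ = refl
gaps-injective (zero ∷ A)  (zero ∷ B)  s g = cong (zero ∷_) (gaps-injective A B (∷-injʳ s) g)
gaps-injective (suc a ∷ A) (suc b ∷ B) s g =
  let a≡b , r = ones-injective a b (gaps-marked A) (gaps-marked B) (List.∷-injectiveʳ g)
  in cong₂ _∷_ (cong suc a≡b) (gaps-injective A B (∷-injʳ s) r)

-- The first marker carries no information. Dropping it leaves `k - 1` entries, one for each extra
-- point.
tail-gaps : (A : Multiset m) → 0 < card A → gaps A ≡ false ∷ List.drop 1 (gaps A)
tail-gaps (zero ∷ A)  h = tail-gaps A h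
tail-gaps (suc a ∷ A) h = refl

encode : (j : ℕ) → Multiset m → Vec Bool (m + j)
encode j A = supp A ++ pad j (List.drop 1 (gaps A))

module _ {j : ℕ} where

  length-tail-gaps : (A : Multiset m) → IsKMultiset (suc j) A → length (List.drop 1 (gaps A)) ≡ j
  length-tail-gaps A e =
    suc-injective (trans (sym (cong length (tail-gaps A (subst (0 <_) (sym e) (s≤s z≤n))))) (trans (length-gaps A) e))

  wt-tail-gaps : (A : Multiset m) → IsKMultiset (suc j) A → wt (supp A) + wt (pad j (List.drop 1 (gaps A))) ≡ suc j
  wt-tail-gaps A e = trans (cong (wt (supp A) +_) (trans (wt-pad _ (length-tail-gaps A e))
    (sym (cong wtL (tail-gaps A (subst (0 <_) (sym e) (s≤s z≤n))))))) (trans (wt-gaps A) e)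

  encode-injective : {A B : Multiset m} → IsKMultiset (suc j) A → IsKMultiset (suc j) B → encode j A ≡ encode j B → A ≡ B
  encode-injective {A = A} {B} a b e = gaps-injective A B (++-injectiveˡ (supp A) (supp B) e)
    (trans (tail-gaps A (subst (0 <_) (sym a) (s≤s z≤n)))
    (trans (cong (false ∷_) (pad-injective _ _ (length-tail-gaps A a) (length-tail-gaps B b) (++-injectiveʳ (supp A) (supp B) e)))
    (sym (tail-gaps B (subst (0 <_) (sym b) (s≤s z≤n))))))

-- From families of multisets to families of sets

wt-empty : ∀ n → wt (replicate n false) ≡ 0
wt-empty zero    = refl
wt-empty (suc n) = wt-empty n

wt-++ : (A : Vec Bool m) (B : Vec Bool n) → wt (A ++ B) ≡ wt A + wt B
wt-++ []      B = refl
wt-++ (a ∷ A) B = trans (cong (b2n a +_) (wt-++ A B)) (sym (+-assoc (b2n a) _ _))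

take-++ : (A : Vec Bool m) (B : Vec Bool n) → take m (A ++ B) ≡ A
take-++ {m} A B = ++-injectiveˡ _ A (take++drop≡id m (A ++ B))

lookup-take : (m : ℕ) (V : Vec Bool (m + n)) (i : Fin m) → lookup (take m V) i ≡ lookup V (i ↑ˡ n)
lookup-take m V i = trans (sym (lookup-++ˡ (take m V) (drop m V) i)) (cong (λ V → lookup V (i ↑ˡ _)) (take++drop≡id m V))

split-index : (m : ℕ) (x : Fin (m + n)) → (∃ λ i → i ↑ˡ n ≡ x) ⊎ (∃ λ y → m ↑ʳ y ≡ x)
split-index m x with splitAt m x in eq
... | inj₁ i = inj₁ (i , splitAt⁻¹-↑ˡ eq)
... | inj₂ y = inj₂ (y , splitAt⁻¹-↑ʳ eq)

does-sound : ∀ {p} {P : Set p} (d : Dec P) → does d ≡ true → P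
does-sound (yes p) _ = p

_≟ᵇ_ : (A B : Vec Bool n) → Dec (A ≡ B)
_≟ᵇ_ = ≡-dec Bool._≟_

-- Each step removes `f x` from the family. Injectivity is asked only on `xs`, because `encode` is
-- known to be injective only on multisets of the prescribed size.
length≤cnt : {X : Set} (f : X → Vec Bool n) (xs : List X) → Unique xs →
  (∀ {x y} → x ∈ xs → y ∈ xs → f x ≡ f y → x ≡ y) →
  (P : Family n) → (∀ {x} → x ∈ xs → P (f x) ≡ true) → length xs ≤ cnt P
length≤cnt f []       _            inj P p = z≤n
length≤cnt f (x ∷ xs) (x∉xs ∷ uxs) inj P p =
  ≤-trans (s≤s (length≤cnt f xs uxs (λ a b → inj (there a) (there b)) P′ p′))
    (cnt-strict {P = P′} {Q = P} (λ A t → proj₁ (∧-elim t)) (f x) (p (here refl)) fx∉P′)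
  where
  P′ : Family _
  P′ A = P A ∧ not (does (A ≟ᵇ f x))
  fx∉P′ : P′ (f x) ≡ false
  fx∉P′ rewrite dec-true (f x ≟ᵇ f x) refl = ∧-zeroʳ (P (f x))
  p′ : ∀ {y} → y ∈ xs → P′ (f y) ≡ true
  p′ {y} y∈ = ∧-intro (p (there y∈)) (differ (f y ≟ᵇ f x))
    where
    differ : (d : Dec (f y ≡ f x)) → not (does d) ≡ true
    differ (no _)  = refl
    differ (yes e) = ⊥-elim (All.lookup x∉xs y∈ (inj (here refl) (there y∈) (sym e)))

traces : (j : ℕ) → List (Multiset m) → Family (m + j)
traces {m} j F V = (wt V ≡ᵇ suc j) ∧ does (any? (λ B → supp B ≟ᵇ take m V) F)

module Transfer {j s : ℕ} (j≤s : j ≤ s)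
  (F : List (Multiset (2 + s))) (unique : Unique F) (sized : All (IsKMultiset (suc j)) F)
  (intersecting : Intersecting F) (nontrivial : EmptyCommonIntersection F) where

  𝒢 : Family (2 + s + j)
  𝒢 = traces j F

  size : ∀ {A} → A ∈ F → card A ≡ suc j
  size = All.lookup sized

  𝒢-elim : ∀ V → 𝒢 V ≡ true → wt V ≡ suc j × ∃ λ B → B ∈ F × supp B ≡ take (2 + s) V
  𝒢-elim V t =
    let w , d = ∧-elim {wt V ≡ᵇ suc j} t
    in ≡ᵇ-sound w , find (does-sound (any? (λ B → supp B ≟ᵇ take (2 + s) V) F) d)

  𝒢-intro : ∀ {B} → B ∈ F → (D : Vec Bool j) → wt (supp B) + wt D ≡ suc j → 𝒢 (supp B ++ D) ≡ true
  𝒢-intro {B} B∈F D w = ∧-intro (≡ᵇ-complete (trans (wt-++ (supp B) D) w))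
    (dec-true (any? (λ C → supp C ≟ᵇ take (2 + s) (supp B ++ D)) F) (lose B∈F (sym (take-++ (supp B) D))))

  encode∈𝒢 : ∀ {B} → B ∈ F → 𝒢 (encode j B) ≡ true
  encode∈𝒢 {B} B∈F = 𝒢-intro B∈F _ (wt-tail-gaps B (size B∈F))

  𝒢-uniform : Uniform (suc j) 𝒢
  𝒢-uniform V t = proj₁ (𝒢-elim V t)

  𝒢-cross : Cross 𝒢 𝒢
  𝒢-cross V W p q =
    let _ , A , A∈F , a = 𝒢-elim V p
        _ , B , B∈F , b = 𝒢-elim W q
        i , v , w = meets-elim (supp A) (supp B) (supp-meets {A = A} {B} (intersecting A∈F B∈F))
    in meets-intro V W (i ↑ˡ j)
         (trans (sym (lookup-take (2 + s) V i)) (trans (cong (λ S → lookup S i) (sym a)) v))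
         (trans (sym (lookup-take (2 + s) W i)) (trans (cong (λ S → lookup S i) (sym b)) w))

  -- If the support of `B` were a single point, every member would have to contain that point.
  wt-supp≥2 : ∀ {B} → B ∈ F → 2 ≤ wt (supp B)
  wt-supp≥2 {B} B∈F with i , i∈B , _ ← ∩-elim {A = B} {B} (intersecting B∈F B∈F) with wt (supp B) in eq
  ... | zero        = ⊥-elim (lookup-wt0 (supp B) i eq (∈-supp B i i∈B))
  ... | suc (suc _) = s≤s (s≤s z≤n)
  ... | suc zero    =
    let C , C∈F , i∉C = nontrivial i
        y , y∈B , y∈C = ∩-elim {A = B} {C} (intersecting B∈F C∈F)
        y≡i = wt1-unique (supp B) y i eq (∈-supp B y y∈B) (∈-supp B i i∈B)
    in ⊥-elim (<-irrefl (sym (trans (cong (λ z → mult z C) y≡i) i∉C)) y∈C)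

  member : ∃ λ B → B ∈ F
  member = let B , B∈F , _ = nontrivial zero in B , B∈F

  defect : ∀ {B} → B ∈ F → ∃ λ d → wt (supp B) + d ≡ suc j × suc d ≤ j
  defect {B} B∈F = suc j ∸ wt (supp B) , w , ≤-pred (≤-trans (+-monoˡ-≤ _ (wt-supp≥2 B∈F)) (≤-reflexive w))
    where
    w : wt (supp B) + (suc j ∸ wt (supp B)) ≡ suc j
    w = m+[n∸m]≡n (≤-trans (wt-supp≤card B) (≤-reflexive (size B∈F)))

  singleton : Fin j → Vec Bool j
  singleton y = replicate j false [ y ]≔ true

  wt-singleton : ∀ y → wt (singleton y) ≡ 1
  wt-singleton y = trans (wt-add (replicate j false) y (lookup-replicate y false)) (cong suc (wt-empty j))

  -- A support with at least two elements needs fewer than `j` extra points, so any one of them can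
  -- be left out.
  extension-avoiding : ∀ {B} → B ∈ F → (y : Fin j) →
    ∃ λ D → 𝒢 (supp B ++ D) ≡ true × lookup D y ≡ false
  extension-avoiding {B} B∈F y with d , w , d<j ← defect B∈F
    with D , wD , miss ← fill (singleton y) d
      (≤-trans (≤-reflexive (trans (cong (d +_) (wt-singleton y)) (+-comm d 1))) d<j) =
    D , 𝒢-intro B∈F D (trans (cong (wt (supp B) +_) wD) w) , y∉D
    where
    y∉D : lookup D y ≡ false
    y∉D with bool-cases (lookup D y)
    ... | inj₂ f = f
    ... | inj₁ t = ⊥-elim (true≢false (meets-intro D (singleton y) y t (lookup∘update y (replicate j false) true)) miss)

  𝒢-nontrivial : Nontrivial 𝒢
  𝒢-nontrivial x with split-index (2 + s) x
  ... | inj₁ (i , refl) = let B , B∈F , i∉B = nontrivial i in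
    encode j B , encode∈𝒢 B∈F , trans (lookup-++ˡ (supp B) _ i) (∉-supp B i i∉B)
  ... | inj₂ (y , refl) = let B , B∈F = member ; D , p , y∉D = extension-avoiding B∈F y in
    supp B ++ D , p , trans (lookup-++ʳ (supp B) D y) y∉D

  length≤ : length F ≤ cnt 𝒢
  length≤ = length≤cnt (encode j) F unique (λ a b → encode-injective (size a) (size b)) 𝒢 encode∈𝒢

  points : suc s + j ≡ suc j + s
  points = cong suc (+-comm s j)

  hm : HMBound j s 𝒢
  hm = hilton-milner (suc s + j) j s points j≤s 𝒢 𝒢-uniform 𝒢-cross 𝒢-nontrivial

  length-bound : length F + bin s j ≤ bin (suc s + j) j + 1
  length-bound = ≤-trans (+-monoˡ-≤ (bin s j) length≤) (proj₁ hm)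

  lone-equal : ∀ x → Lone x 𝒢 → ∀ V W → 𝒢 V ≡ true → lookup V x ≡ false → 𝒢 W ≡ true → lookup W x ≡ false → V ≡ W
  lone-equal x lone V W p f q g =
    cnt≤1⇒unique (avoiding x 𝒢) lone {V} {W} (∧-intro p (cong not f)) (∧-intro q (cong not g))

  -- Two members of `F` with different supports both have completions that miss `y`.
  lone-dummy : (y : Fin j) → ¬ Lone ((2 + s) ↑ʳ y) 𝒢
  lone-dummy y lone =
    let A , A∈F = member
        i , i∈A , _ = ∩-elim {A = A} {A} (intersecting A∈F A∈F)
        B , B∈F , i∉B = nontrivial i
        D , p , y∉D = extension-avoiding A∈F y
        E , q , y∉E = extension-avoiding B∈F y
        supp≡ = ++-injectiveˡ (supp A) (supp B) (lone-equal ((2 + s) ↑ʳ y) lone (supp A ++ D) (supp B ++ E)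
          p (trans (lookup-++ʳ (supp A) D y) y∉D) q (trans (lookup-++ʳ (supp B) E y) y∉E))
    in true≢false (∈-supp A i i∈A) (trans (cong (λ S → lookup S i) supp≡) (∉-supp B i i∉B))

  missing : ∀ i (B : Multiset (2 + s)) → mult i B ≡ 0 → (D : Vec Bool j) → lookup (supp B ++ D) (i ↑ˡ j) ≡ false
  missing i B i∉B D = trans (lookup-++ˡ (supp B) D i) (∉-supp B i i∉B)

  -- A member of F missing i with a repeated element would have several encodings that miss i.
  lone-full : ∀ i → Lone (i ↑ˡ j) 𝒢 → Fin j → ∀ {Y} → Y ∈ F → mult i Y ≡ 0 → wt (supp Y) ≡ suc j
  lone-full i lone y {Y} Y∈F i∉Y with defect Y∈F
  ... | zero  , w , _   = trans (sym (+-identityʳ _)) w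
  ... | suc d , w , d<j =
    let D , p , y∉D = extension-avoiding Y∈F y
        E , wE , _ , y∈E = fill-with (replicate j false) d y (lookup-replicate y false)
          (≤-trans (≤-reflexive (trans (cong (suc d +_) (wt-empty j)) (+-identityʳ _))) (<⇒≤ d<j))
        E≡D = ++-injectiveʳ (supp Y) (supp Y) (lone-equal (i ↑ˡ j) lone (supp Y ++ E) (supp Y ++ D)
          (𝒢-intro Y∈F E (trans (cong (wt (supp Y) +_) wE) w)) (missing i Y i∉Y E) p (missing i Y i∉Y D))
    in ⊥-elim (true≢false y∈E (trans (cong (λ V → lookup V y) E≡D) y∉D))

  -- Tightness for `F` forces tightness for `𝒢`, whose lone point cannot be an extra one. Uniqueness
  -- among the sets of `𝒢` then gives uniqueness in `F`, because `encode` is injective there.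
  lone-exception : 3 ≤ j → j < s → bin (suc s + j) j + 1 ≤ length F + bin s j →
    ∃ λ x → ∃ λ Y → Y ∈ F × mult x Y ≡ 0 × wt (supp Y) ≡ suc j × (∀ {B} → B ∈ F → mult x B ≡ 0 → B ≡ Y)
  lone-exception 3≤j j<s tight with proj₂ hm 3≤j j<s (≤-trans tight (+-monoˡ-≤ (bin s j) length≤))
  ... | x , lone with split-index (2 + s) x
  ... | inj₂ (y , refl) = ⊥-elim (lone-dummy y lone)
  ... | inj₁ (i , refl) = let Y , Y∈F , i∉Y = nontrivial i in
    i , Y , Y∈F , i∉Y , lone-full i lone (fromℕ< (≤-trans (s≤s z≤n) 3≤j)) Y∈F i∉Y ,
    λ {B} B∈F i∉B → encode-injective (size B∈F) (size Y∈F)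
      (lone-equal (i ↑ˡ j) lone (encode j B) (encode j Y) (encode∈𝒢 B∈F) (missing i B i∉B _) (encode∈𝒢 Y∈F) (missing i Y i∉Y _))

bin≡choose : ∀ n k → bin n k ≡ n choose k
bin≡choose n       zero    = refl
bin≡choose zero    (suc k) = sym (k>n⇒nCk≡0 {0} {suc k} (s≤s z≤n))
bin≡choose (suc n) (suc k) = trans (cong₂ _+_ (bin≡choose n k) (bin≡choose n (suc k))) (nCk+nC[k+1]≡[n+1]C[k+1] n k)

-- Intervals

-- The entry function of interval is local to its definition, so it is recovered by unification.
interval-entries : ∀ x y → Σ (Fin m → ℕ) λ f → interval x y ≡ tabulate f
interval-entries x y = _ , refl

indicator : ∀ {p q} {P : Set p} {Q : Set q} → Dec P → Dec Q → ℕ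
indicator (yes _) (yes _) = 1
indicator _       _       = 0

interval-entry : ∀ x y (i : Fin m) →
  proj₁ (interval-entries x y) i ≡ indicator (x ≤? suc (toℕ i)) (suc (toℕ i) ≤? y)
interval-entry x y i with x ≤? suc (toℕ i) | suc (toℕ i) ≤? y
... | yes _ | yes _ = refl
... | yes _ | no _  = refl
... | no _  | yes _ = refl
... | no _  | no _  = refl

indicator≡b2n : ∀ {p q} {P : Set p} {Q : Set q} (d : Dec P) (e : Dec Q) → indicator d e ≡ b2n (does d ∧ does e)
indicator≡b2n (yes _) (yes _) = refl
indicator≡b2n (yes _) (no _)  = refl
indicator≡b2n (no _)  (yes _) = refl
indicator≡b2n (no _)  (no _)  = refl

lookup-interval : ∀ x y (i : Fin m) → lookup (interval x y) i ≡ b2n ((x ≤ᵇ suc (toℕ i)) ∧ (suc (toℕ i) ≤ᵇ y))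
lookup-interval x y i = begin
  lookup (interval x y) i                                ≡⟨ lookup∘tabulate (proj₁ (interval-entries x y)) i ⟩
  proj₁ (interval-entries x y) i                         ≡⟨ interval-entry x y i ⟩
  indicator (x ≤? suc (toℕ i)) (suc (toℕ i) ≤? y)        ≡⟨ indicator≡b2n (x ≤? suc (toℕ i)) (suc (toℕ i) ≤? y) ⟩
  b2n ((x ≤ᵇ suc (toℕ i)) ∧ (suc (toℕ i) ≤ᵇ y))          ∎
  where open ≡-Reasoning

-- Index `suc t` stands for the element `t + 2`, which lies in `[2, k + 1]` exactly if `t < k`.
inSegment : ℕ → ℕ → Bool
inSegment k zero    = false
inSegment k (suc t) = t <ᵇ k

lookup-segment : ∀ k (i : Fin m) → lookup (interval 2 (k + 1)) i ≡ b2n (inSegment k (toℕ i))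
lookup-segment k i rewrite +-comm k 1 = trans (lookup-interval 2 (suc k) i) (cong b2n (entries (toℕ i)))
  where
  entries : ∀ t → (2 ≤ᵇ suc t) ∧ (suc t ≤ᵇ suc k) ≡ inSegment k t
  entries zero    = refl
  entries (suc t) = refl

one∈-intro : (A : Multiset (suc m)) → 0 < mult zero A → 1 ∈ₘ A
one∈-intro {m} A h = ∩-intro {A = A} {interval 1 1} zero h (subst (0 <_) (sym (lookup-interval {suc m} 1 1 zero)) z<s)

one∈-elim : (A : Multiset (suc m)) → 1 ∈ₘ A → 0 < mult zero A
one∈-elim A h with ∩-elim {A = A} {interval 1 1} h
... | zero  , a , _ = a
... | suc i , _ , b with () ← subst (0 <_) (lookup-interval 1 1 (suc i)) b

-- Permuting multisets

lookup-extensional : {A B : Multiset m} → (∀ i → lookup A i ≡ lookup B i) → A ≡ B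
lookup-extensional {A = A} {B} e = trans (sym (tabulate∘lookup A)) (trans (tabulate-cong e) (tabulate∘lookup B))

lookup-permute : (σ : Fin m ↔ Fin m) (A : Multiset m) (i : Fin m) → mult i (permute σ A) ≡ mult (σ ⟨$⟩ˡ i) A
lookup-permute σ A = lookup∘tabulate _

lookup-permute-image : (σ : Fin m ↔ Fin m) (A : Multiset m) (i : Fin m) → mult (σ ⟨$⟩ʳ i) (permute σ A) ≡ mult i A
lookup-permute-image σ A i = trans (lookup-permute σ A (σ ⟨$⟩ʳ i)) (cong (lookup A) (inverseˡ σ))

permute-flip : (σ : Fin m ↔ Fin m) (A : Multiset m) → permute σ (permute (flip σ) A) ≡ A
permute-flip σ A = lookup-extensional λ i →
  trans (lookup-permute σ (permute (flip σ) A) i) (trans (lookup-permute (flip σ) A (σ ⟨$⟩ˡ i)) (cong (lookup A) (inverseʳ σ)))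

permute-injective : (σ : Fin m ↔ Fin m) {A B : Multiset m} → permute σ A ≡ permute σ B → A ≡ B
permute-injective σ {A} {B} e = lookup-extensional λ i →
  trans (sym (lookup-permute-image σ A i)) (trans (cong (mult (σ ⟨$⟩ʳ i)) e) (lookup-permute-image σ B i))

card-permute : (σ : Fin m ↔ Fin m) (A : Multiset m) → card (permute σ A) ≡ card A
card-permute σ A = trans (sum-tabulate (λ i → lookup A (σ ⟨$⟩ˡ i)))
  (trans (sym (sum-permute (lookup A) (flip σ)))
  (trans (sym (sum-tabulate (lookup A))) (cong sum (tabulate∘lookup A))))
  where
  open import Algebra.Properties.CommutativeMonoid.Sum +-0-commutativeMonoid using (sum-permute) renaming (sum to ∑)
  sum-tabulate : ∀ {n} (f : Fin n → ℕ) → sum (tabulate f) ≡ ∑ f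
  sum-tabulate {zero}  f = refl
  sum-tabulate {suc n} f = cong (f zero +_) (sum-tabulate (f ∘ suc))

permute-∩ : (σ : Fin m ↔ Fin m) {A B : Multiset m} → NonEmpty (A ∩ B) → NonEmpty (permute σ A ∩ permute σ B)
permute-∩ σ {A} {B} h = let i , a , b = ∩-elim {A = A} {B} h in
  ∩-intro {A = permute σ A} {permute σ B} (σ ⟨$⟩ʳ i)
    (subst (0 <_) (sym (lookup-permute-image σ A i)) a) (subst (0 <_) (sym (lookup-permute-image σ B i)) b)

permute-∩⁻ : (σ : Fin m ↔ Fin m) {A B : Multiset m} → NonEmpty (permute σ A ∩ permute σ B) → NonEmpty (A ∩ B)
permute-∩⁻ σ {A} {B} h = let i , a , b = ∩-elim {A = permute σ A} {permute σ B} h in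
  ∩-intro {A = A} {B} (σ ⟨$⟩ˡ i) (subst (0 <_) (lookup-permute σ A i) a) (subst (0 <_) (lookup-permute σ B i) b)

-- Permutations that sort a set

insert-self : (i : Fin (suc m)) (j : Fin (suc n)) (π : Permutation m n) → insert i j π ⟨$⟩ʳ i ≡ j
insert-self i j π with i Fin.≟ i
... | yes _   = refl
... | no  i≢i = contradiction refl i≢i

toℕ-punchIn-last : (t : Fin n) → toℕ (punchIn (fromℕ n) t) ≡ toℕ t
toℕ-punchIn-last zero    = refl
toℕ-punchIn-last (suc t) = cong suc (toℕ-punchIn-last t)

<ᵇ-false : ∀ {a b} → b ≤ a → (a <ᵇ b) ≡ false
<ᵇ-false {a}     {zero}  _         = refl
<ᵇ-false {suc a} {suc b} (s≤s b≤a) = <ᵇ-false b≤a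

-- A head inside the set stays in front. A head outside is sent to the last position, which leaves
-- the positions of all other points unchanged.
sorting : (R : Vec Bool n) → ∃ λ (τ : Permutation n n) → ∀ i → lookup R i ≡ (toℕ (τ ⟨$⟩ʳ i) <ᵇ wt R)
sorting []      = Perm.id , λ ()
sorting (true ∷ R) = let τ , e = sorting R in lift₀ τ , λ { zero → refl ; (suc i) → e i }
sorting {suc n} (false ∷ R) with τ , e ← sorting R = insert zero (fromℕ n) τ , λ where
  zero    → sym (trans (cong (_<ᵇ wt R) (toℕ-fromℕ n)) (<ᵇ-false (wt≤n R)))
  (suc i) → trans (e i) (cong (_<ᵇ wt R) (sym (trans
    (cong toℕ (insert-punchIn zero (fromℕ n) τ i)) (toℕ-punchIn-last (τ ⟨$⟩ʳ i)))))

-- Meant for the lone point `x` and the support `S` of the exceptional member: they become the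
-- element 1 and the segment starting at 2.
standardise : (x : Fin (suc n)) (S : Vec Bool (suc n)) → lookup S x ≡ false →
  ∃ λ (σ : Permutation (suc n) (suc n)) → (σ ⟨$⟩ʳ x ≡ zero) × (∀ i → lookup S i ≡ inSegment (wt S) (toℕ (σ ⟨$⟩ʳ i)))
standardise x S x∉S with τ , e ← sorting (removeAt S x) = insert x zero τ , insert-self x zero τ , segment
  where
  S≡ : insertAt (removeAt S x) x false ≡ S
  S≡ = insertAt-removeAt-at S x x∉S
  wtR : wt (removeAt S x) ≡ wt S
  wtR = trans (sym (wt-insert (removeAt S x) x false)) (cong wt S≡)
  segment : ∀ i → lookup S i ≡ inSegment (wt S) (toℕ (insert x zero τ ⟨$⟩ʳ i))
  segment i with x Fin.≟ i
  ... | yes refl = x∉S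
  ... | no  x≢i  = begin
    lookup S i                                                          ≡⟨ cong₂ lookup (sym S≡) (sym (punchIn-punchOut x≢i)) ⟩
    lookup (insertAt (removeAt S x) x false) (punchIn x (punchOut x≢i)) ≡⟨ insertAt-punchIn (removeAt S x) x false (punchOut x≢i) ⟩
    lookup (removeAt S x) (punchOut x≢i)                                ≡⟨ e (punchOut x≢i) ⟩
    (toℕ (τ ⟨$⟩ʳ punchOut x≢i) <ᵇ wt (removeAt S x))                    ≡⟨ cong (toℕ (τ ⟨$⟩ʳ punchOut x≢i) <ᵇ_) wtR ⟩
    (toℕ (τ ⟨$⟩ʳ punchOut x≢i) <ᵇ wt S)                                 ∎
    where open ≡-Reasoning

-- Enumerating multisets

bump : Multiset (suc n) → Multiset (suc n)
bump (a ∷ A) = suc a ∷ A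

bump-injective : {A B : Multiset (suc n)} → bump A ≡ bump B → A ≡ B
bump-injective {A = a ∷ A} {.a ∷ .A} refl = refl

multisetsAvoiding : Vec Bool n → ℕ → List (Multiset n)
multisetsAvoiding []          zero    = [] ∷ []
multisetsAvoiding []          (suc k) = []
multisetsAvoiding (true ∷ Z)  k       = List.map (0 ∷_) (multisetsAvoiding Z k)
multisetsAvoiding (false ∷ Z) zero    = List.map (0 ∷_) (multisetsAvoiding Z zero)
multisetsAvoiding (false ∷ Z) (suc k) =
  List.map (0 ∷_) (multisetsAvoiding Z (suc k)) List.++ List.map bump (multisetsAvoiding (false ∷ Z) k)

length-multisetsAvoiding-all : (Z : Vec Bool n) (k : ℕ) → wt Z ≡ n → length (multisetsAvoiding Z k) ≡ bin 0 k
length-multisetsAvoiding-all []         zero    _ = refl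
length-multisetsAvoiding-all []         (suc k) _ = refl
length-multisetsAvoiding-all (true ∷ Z) k       e =
  trans (List.length-map (0 ∷_) (multisetsAvoiding Z k)) (length-multisetsAvoiding-all Z k (suc-injective e))
length-multisetsAvoiding-all (false ∷ Z) k      e = contradiction (≤-trans (≤-reflexive (sym e)) (wt≤n Z)) 1+n≰n

-- The stars-and-bars number for `suc r` admissible elements; the case without admissible elements
-- is `length-multisetsAvoiding-all`. Splitting by whether the first admissible multiplicity is zero
-- reproduces Pascal's rule.
length-multisetsAvoiding : (Z : Vec Bool n) (r k : ℕ) → wt Z + suc r ≡ n → length (multisetsAvoiding Z k) ≡ bin (r + k) k
length-multisetsAvoiding (true ∷ Z) r k e =
  trans (List.length-map (0 ∷_) (multisetsAvoiding Z k)) (length-multisetsAvoiding Z r k (suc-injective e))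
length-multisetsAvoiding (false ∷ Z) zero zero e =
  trans (List.length-map (0 ∷_) (multisetsAvoiding Z zero))
    (length-multisetsAvoiding-all Z zero (trans (sym (+-identityʳ _)) (suc-injective (trans (sym (+-suc (wt Z) 0)) e))))
length-multisetsAvoiding (false ∷ Z) (suc r) zero e =
  trans (List.length-map (0 ∷_) (multisetsAvoiding Z zero))
    (length-multisetsAvoiding Z r zero (suc-injective (trans (sym (+-suc (wt Z) (suc r))) e)))
length-multisetsAvoiding (false ∷ Z) r (suc k) e = begin
  length (List.map (0 ∷_) (multisetsAvoiding Z (suc k)) List.++ List.map bump (multisetsAvoiding (false ∷ Z) k))
    ≡⟨ List.length-++ (List.map (0 ∷_) (multisetsAvoiding Z (suc k))) ⟩
  length (List.map (0 ∷_) (multisetsAvoiding Z (suc k))) + length (List.map bump (multisetsAvoiding (false ∷ Z) k))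
    ≡⟨ cong₂ _+_ (List.length-map (0 ∷_) (multisetsAvoiding Z (suc k)))
        (trans (List.length-map bump (multisetsAvoiding (false ∷ Z) k)) (length-multisetsAvoiding (false ∷ Z) r k e)) ⟩
  length (multisetsAvoiding Z (suc k)) + bin (r + k) k
    ≡⟨ rest r e ⟩
  bin (r + suc k) (suc k) ∎
  where
  open ≡-Reasoning
  rest : ∀ r → wt Z + suc r ≡ _ → length (multisetsAvoiding Z (suc k)) + bin (r + k) k ≡ bin (r + suc k) (suc k)
  rest zero e rewrite length-multisetsAvoiding-all Z (suc k) (trans (sym (+-identityʳ _)) (suc-injective (trans (sym (+-suc (wt Z) 0)) e))) =
    trans (bin-diag k) (sym (bin-diag (suc k)))
  rest (suc r) e rewrite length-multisetsAvoiding Z r (suc k) (suc-injective (trans (sym (+-suc (wt Z) (suc r))) e)) | +-suc r k =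
    +-comm (bin (suc (r + k)) (suc k)) _

multisetsAvoiding-card : (Z : Vec Bool n) (k : ℕ) {A : Multiset n} → A ∈ multisetsAvoiding Z k → card A ≡ k
multisetsAvoiding-card []         zero    (here refl) = refl
multisetsAvoiding-card (true ∷ Z) k       p with ∈-map⁻ (0 ∷_) p
... | _ , q , refl = multisetsAvoiding-card Z k q
multisetsAvoiding-card (false ∷ Z) zero   p with ∈-map⁻ (0 ∷_) p
... | _ , q , refl = multisetsAvoiding-card Z zero q
multisetsAvoiding-card (false ∷ Z) (suc k) p with ∈-++⁻ (List.map (0 ∷_) (multisetsAvoiding Z (suc k))) p
... | inj₁ p′ with ∈-map⁻ (0 ∷_) p′
...   | _ , q , refl = multisetsAvoiding-card Z (suc k) q
multisetsAvoiding-card (false ∷ Z) (suc k) p | inj₂ p′ with ∈-map⁻ bump p′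
...   | _ ∷ _ , q , refl = cong suc (multisetsAvoiding-card (false ∷ Z) k q)

multisetsAvoiding-complete : (Z : Vec Bool n) (k : ℕ) (A : Multiset n) → card A ≡ k → meets (supp A) Z ≡ false →
  A ∈ multisetsAvoiding Z k
multisetsAvoiding-complete []          zero    []          _ _ = here refl
multisetsAvoiding-complete (true ∷ Z)  k       (zero ∷ A)  e f = ∈-map⁺ (0 ∷_) (multisetsAvoiding-complete Z k A e f)
multisetsAvoiding-complete (false ∷ Z) zero    (zero ∷ A)  e f = ∈-map⁺ (0 ∷_) (multisetsAvoiding-complete Z zero A e f)
multisetsAvoiding-complete (false ∷ Z) (suc k) (zero ∷ A)  e f =
  ∈-++⁺ˡ (∈-map⁺ (0 ∷_) (multisetsAvoiding-complete Z (suc k) A e f))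
multisetsAvoiding-complete (false ∷ Z) (suc k) (suc a ∷ A) e f =
  ∈-++⁺ʳ (List.map (0 ∷_) (multisetsAvoiding Z (suc k)))
    (∈-map⁺ bump (multisetsAvoiding-complete (false ∷ Z) k (a ∷ A) (suc-injective e) (trans (head-irrelevant a) f)))
  where
  head-irrelevant : ∀ a → meets (supp (a ∷ A)) (false ∷ Z) ≡ meets (supp A) Z
  head-irrelevant zero    = refl
  head-irrelevant (suc a) = refl

multisetsAvoiding-unique : (Z : Vec Bool n) (k : ℕ) → Unique (multisetsAvoiding Z k)
multisetsAvoiding-unique []          zero    = [] ∷ []
multisetsAvoiding-unique []          (suc k) = []
multisetsAvoiding-unique (true ∷ Z)  k       = Unique.map⁺ (λ { refl → refl }) (multisetsAvoiding-unique Z k)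
multisetsAvoiding-unique (false ∷ Z) zero    = Unique.map⁺ (λ { refl → refl }) (multisetsAvoiding-unique Z zero)
multisetsAvoiding-unique (false ∷ Z) (suc k) =
  Unique.++⁺ (Unique.map⁺ (λ { refl → refl }) (multisetsAvoiding-unique Z (suc k)))
    (Unique.map⁺ bump-injective (multisetsAvoiding-unique (false ∷ Z) k)) disjoint
  where
  disjoint : ∀ {A} → A ∈ List.map (0 ∷_) (multisetsAvoiding Z (suc k)) × A ∈ List.map bump (multisetsAvoiding (false ∷ Z) k) → ⊥
  disjoint (p , q) with ∈-map⁻ (0 ∷_) p | ∈-map⁻ bump q
  ... | _ , _ , refl | _ ∷ _ , _ , ()

length-⊆ : {X : Set} (xs ys : List X) → Unique xs → (∀ {x} → x ∈ xs → x ∈ ys) → length xs ≤ length ys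
length-⊆ []       ys _            _ = z≤n
length-⊆ (x ∷ xs) ys (x∉xs ∷ uxs) s with ∈-∃++ (s (here refl))
... | as , bs , refl = begin
  suc (length xs)                  ≤⟨ s≤s (length-⊆ xs (as List.++ bs) uxs drop-x) ⟩
  suc (length (as List.++ bs))     ≡⟨ cong suc (List.length-++ as) ⟩
  suc (length as + length bs)      ≡⟨ +-suc (length as) (length bs) ⟨
  length as + length (x ∷ bs)      ≡⟨ List.length-++ as ⟨
  length (as List.++ x ∷ bs)       ∎
  where
  open ≤-Reasoning
  drop-x : ∀ {y} → y ∈ xs → y ∈ as List.++ bs
  drop-x {y} y∈ with ∈-++⁻ as (s (there y∈))
  ... | inj₁ p           = ∈-++⁺ˡ p
  ... | inj₂ (there p)   = ∈-++⁺ʳ as p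
  ... | inj₂ (here refl) = ⊥-elim (All.lookup x∉xs y∈ refl)

-- The extremal family

module Extremal {j s : ℕ} (j≤s : j ≤ s) (F : List (Multiset (2 + s))) (sized : All (IsKMultiset (suc j)) F) where

  segment : Multiset (2 + s)
  segment = interval 2 (suc j + 1)

  module _ (σ : Fin (2 + s) ↔ Fin (2 + s))
    (iso : ∀ A → (A ∈ F → InFtilde (2 + s) (suc j) (permute σ A)) × (InFtilde (2 + s) (suc j) (permute σ A) → A ∈ F)) where

    image : ∀ {A} → InFtilde (2 + s) (suc j) A → A ∈ List.map (permute σ) F
    image {A} h = subst (_∈ List.map (permute σ) F) (permute-flip σ A)
      (∈-map⁺ (permute σ) (proj₂ (iso (permute (flip σ) A)) (subst (InFtilde (2 + s) (suc j)) (sym (permute-flip σ A)) h)))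

    -- The segment belongs to the permuted `F`, all of whose members have size `suc j`, so no
    -- entries need to be summed.
    card-segment : card segment ≡ suc j
    card-segment with A , A∈F , e ← ∈-map⁻ (permute σ) (image (inj₂ refl)) =
      trans (cong card e) (trans (card-permute σ A) (All.lookup sized A∈F))

    wt-segment : wt (supp segment) ≡ suc j
    wt-segment = trans (squarefree segment λ i → subst (_≤ 1) (sym (lookup-segment (suc j) i))
      (b2n≤1 (inSegment (suc j) (toℕ i)))) card-segment
      where
      b2n≤1 : ∀ b → b2n b ≤ 1
      b2n≤1 true  = ≤-refl
      b2n≤1 false = z≤n
      squarefree : ∀ {n} (A : Multiset n) → (∀ i → mult i A ≤ 1) → wt (supp A) ≡ card A
      squarefree []          h = refl
      squarefree (zero ∷ A)  h = squarefree A (h ∘ suc)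
      squarefree (suc zero ∷ A) h = cong suc (squarefree A (h ∘ suc))
      squarefree (suc (suc a) ∷ A) h with () ← ≤-pred (h zero)

    everything : List (Multiset (2 + s))
    everything = multisetsAvoiding (replicate (2 + s) false) j

    missed : List (Multiset (2 + s))
    missed = multisetsAvoiding (supp segment) j

    covered : ∀ {A} → A ∈ segment ∷ List.map bump everything → A ∈ List.map (permute σ) F List.++ List.map bump missed
    covered (here refl) = ∈-++⁺ˡ (image (inj₂ refl))
    covered (there p) with a ∷ A , q , refl ← ∈-map⁻ bump p with bool-cases (meets (supp (a ∷ A)) (supp segment))
    ... | inj₂ f = ∈-++⁺ʳ (List.map (permute σ) F) (∈-map⁺ bump
      (multisetsAvoiding-complete (supp segment) j (a ∷ A) (multisetsAvoiding-card (replicate (2 + s) false) j q) f))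
    ... | inj₁ t with meets-elim (supp (a ∷ A)) (supp segment) t
    ...   | i , i∈A , i∈I = ∈-++⁺ˡ (image (inj₁
      ( cong suc (multisetsAvoiding-card (replicate (2 + s) false) j q)
      , one∈-intro (suc a ∷ A) (s≤s z≤n)
      , ∩-intro {A = suc a ∷ A} {segment} i (bump-positive i (supp-∈ (a ∷ A) i i∈A)) (supp-∈ segment i i∈I))))
      where
      bump-positive : ∀ i → 0 < lookup (a ∷ A) i → 0 < lookup (suc a ∷ A) i
      bump-positive zero    _ = s≤s z≤n
      bump-positive (suc i) h = h

    -- Since the upper bound is available separately, covering suffices in place of an exact count.
    -- Bumping all `j`-multisets gives the `k`-multisets that contain 1. Those missing the segment
    -- use only `s - j + 1` elements and number `bin s j`; the others, and the segment itself, lie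
    -- in the permuted `F`.
    length-lower-bound : bin (suc s + j) j + 1 ≤ length F + bin s j
    length-lower-bound = begin
      bin (suc s + j) j + 1                              ≡⟨ +-comm _ 1 ⟩
      suc (bin (suc s + j) j)                            ≡⟨ cong suc (length-multisetsAvoiding (replicate (2 + s) false) (suc s) j
                                                              (cong (_+ (2 + s)) (wt-empty (2 + s)))) ⟨
      suc (length everything)                            ≡⟨ cong suc (List.length-map bump everything) ⟨
      length (segment ∷ List.map bump everything)        ≤⟨ length-⊆ _ _ distinct covered ⟩
      length (List.map (permute σ) F List.++ List.map bump missed)
                                                         ≡⟨ List.length-++ (List.map (permute σ) F) ⟩
      length (List.map (permute σ) F) + length (List.map bump missed)
                                                         ≡⟨ cong₂ _+_ (List.length-map (permute σ) F) (List.length-map bump missed) ⟩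
      length F + length missed                           ≡⟨ cong (length F +_) (length-multisetsAvoiding (supp segment) (s ∸ j) j
                                                              (trans (cong (_+ suc (s ∸ j)) wt-segment) (cong suc (trans (+-suc j _) (cong suc (m+[n∸m]≡n j≤s)))))) ⟩
      length F + bin (s ∸ j + j) j                       ≡⟨ cong (λ z → length F + bin z j) (m∸n+n≡m j≤s) ⟩
      length F + bin s j                                 ∎
      where
      open ≤-Reasoning
      head-differs : ∀ {A} → A ∈ List.map bump everything → segment ≢ A
      head-differs p e with ∈-map⁻ bump p
      ... | _ ∷ _ , _ , refl with () ← e
      distinct : Unique (segment ∷ List.map bump everything)
      distinct = All.tabulate head-differs ∷ Unique.map⁺ bump-injective (multisetsAvoiding-unique (replicate (2 + s) false) j)

-- Families that attain the bound

module Equality {j s : ℕ} (3≤j : 3 ≤ j) (j<s : j < s)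
  (F : List (Multiset (2 + s))) (unique : Unique F) (sized : All (IsKMultiset (suc j)) F)
  (intersecting : Intersecting F) (nontrivial : EmptyCommonIntersection F)
  (tight : bin (suc s + j) j + 1 ≤ length F + bin s j)
  (x : Fin (2 + s)) (Y : Multiset (2 + s)) (Y∈F : Y ∈ F) (x∉Y : mult x Y ≡ 0) (wtY : wt (supp Y) ≡ suc j)
  (only : ∀ {B} → B ∈ F → mult x B ≡ 0 → B ≡ Y) where

  size : ∀ {A} → A ∈ F → card A ≡ suc j
  size = All.lookup sized

  positive-or-Y : ∀ {B} → B ∈ F → 0 < mult x B ⊎ B ≡ Y
  positive-or-Y {B} B∈F with mult x B in eq
  ... | zero  = inj₂ (only B∈F eq)
  ... | suc _ = inj₁ (s≤s z≤n)

  -- Otherwise A could be added to F, contradicting the bound.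
  maximal : ∀ A → IsKMultiset (suc j) A → 0 < mult x A → NonEmpty (A ∩ Y) → A ∈ F
  maximal A sizeA x∈A A∩Y with DecMembership._∈?_ (≡-dec _≟_) A F
  ... | yes A∈F = A∈F
  ... | no  A∉F = contradiction (≤-trans (Transfer.length-bound (<⇒≤ j<s) (A ∷ F) unique′ (sizeA ∷ sized)
      (λ {B} {D} → intersecting′ {B} {D}) (λ i → let B , B∈F , i∉B = nontrivial i in B , there B∈F , i∉B)) tight) 1+n≰n
    where
    unique′ : Unique (A ∷ F)
    unique′ = All.tabulate (λ B∈F e → A∉F (subst (_∈ F) (sym e) B∈F)) ∷ unique
    with-A : ∀ {B} → B ∈ F → NonEmpty (A ∩ B)
    with-A {B} B∈F with positive-or-Y B∈F
    ... | inj₁ x∈B  = ∩-intro {A = A} {B} x x∈A x∈B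
    ... | inj₂ refl = A∩Y
    intersecting′ : Intersecting (A ∷ F)
    intersecting′ (here refl) (here refl) = ∩-intro {A = A} {A} x x∈A x∈A
    intersecting′ (here refl) (there D∈F) = with-A D∈F
    intersecting′ {B} (there B∈F) (here refl) = ∩-sym {A = A} {B} (with-A B∈F)
    intersecting′ (there B∈F) (there D∈F) = intersecting B∈F D∈F

  -- The support of `Y` has as many elements as `Y`, so `Y` is a set, and the permutation that sorts
  -- its support takes it exactly to the segment and `x` to 1. Maximality then supplies every
  -- multiset of the extremal family.
  isomorphic : IsomorphicTo F (InFtilde (2 + s) (suc j))
  isomorphic with σ , σx , σY ← standardise x (supp Y) (∉-supp Y x x∉Y) = σ , λ A → to A , from A
    where
    σY≡segment : permute σ Y ≡ interval 2 (suc j + 1)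
    σY≡segment = lookup-extensional λ i → begin
      lookup (permute σ Y) i                                    ≡⟨ lookup-permute σ Y i ⟩
      lookup Y (σ ⟨$⟩ˡ i)                                       ≡⟨ wt-supp≡card Y (trans wtY (sym (size Y∈F))) (σ ⟨$⟩ˡ i) ⟩
      b2n (lookup (supp Y) (σ ⟨$⟩ˡ i))                          ≡⟨ cong b2n (σY (σ ⟨$⟩ˡ i)) ⟩
      b2n (inSegment (wt (supp Y)) (toℕ (σ ⟨$⟩ʳ (σ ⟨$⟩ˡ i))))  ≡⟨ cong₂ (λ w t → b2n (inSegment w (toℕ t))) wtY (inverseʳ σ) ⟩
      b2n (inSegment (suc j) (toℕ i))                           ≡⟨ lookup-segment (suc j) i ⟨
      lookup (interval 2 (suc j + 1)) i                         ∎
      where open ≡-Reasoning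
    mult-zero : ∀ A → mult zero (permute σ A) ≡ mult x A
    mult-zero A = trans (cong (λ i → mult i (permute σ A)) (sym σx)) (lookup-permute-image σ A x)
    to : ∀ A → A ∈ F → InFtilde (2 + s) (suc j) (permute σ A)
    to A A∈F with positive-or-Y A∈F
    ... | inj₂ refl = inj₂ σY≡segment
    ... | inj₁ x∈A  = inj₁
      ( trans (card-permute σ A) (size A∈F)
      , one∈-intro (permute σ A) (subst (0 <_) (sym (mult-zero A)) x∈A)
      , subst (λ I → NonEmpty (permute σ A ∩ I)) σY≡segment (permute-∩ σ {A} {Y} (intersecting A∈F Y∈F)))
    from : ∀ A → InFtilde (2 + s) (suc j) (permute σ A) → A ∈ F
    from A (inj₂ e) = subst (_∈ F) (permute-injective σ (trans σY≡segment (sym e))) Y∈F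
    from A (inj₁ (sizeA , one∈A , A∩I)) = maximal A (trans (sym (card-permute σ A)) sizeA)
      (subst (0 <_) (mult-zero A) (one∈-elim (permute σ A) one∈A))
      (permute-∩⁻ σ {A} {Y} (subst (λ I → NonEmpty (permute σ A ∩ I)) (sym σY≡segment) A∩I))

-- The bound for multisets and its equality case

theorem3p3 : (k m : ℕ) → 1 < k → k ≤ m ∸ 1 →
    (F : List (Multiset m)) → Unique F → All (IsKMultiset k) F →
    Intersecting F → EmptyCommonIntersection F →
    (length F ≤ bound m k)
    × (3 < k → k < m ∸ 1 → (length F ≡ bound m k ⇔ IsomorphicTo F (InFtilde m k)))
theorem3p3 (suc j) (suc (suc s)) 1<k (s≤s j≤s) F unique sized intersecting nontrivial = upper , λ 3<k k<m-1 →
  let open Case (≤-pred 3<k) (≤-pred k<m-1) in mk⇔ forward backward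
  where
  open Transfer j≤s F unique sized intersecting nontrivial using (length-bound; lone-exception; member)
  a = bin (suc s + j) j
  b = bin s j
  bound≡ : bound (2 + s) (suc j) ≡ a ∸ b + 1
  bound≡ = cong₂ (λ u v → u ∸ v + 1)
    (trans (cong (_choose j) (+-suc s j)) (sym (bin≡choose (suc s + j) j))) (sym (bin≡choose s j))
  nonempty : 1 ≤ length F
  nonempty = ∈-length (proj₂ member)
  -- Ensures that the truncated subtraction in `bound` is a true one; it is read off from the bound
  -- for the nonempty family `F`.
  b≤a : b ≤ a
  b≤a = +-cancelˡ-≤ 1 b a (≤-trans (+-monoˡ-≤ b nonempty) (≤-trans length-bound (≤-reflexive (+-comm a 1))))
  bound+b : bound (2 + s) (suc j) + b ≡ a + 1
  bound+b = trans (cong (_+ b) bound≡) (trans (regroup (a ∸ b) b) (cong (_+ 1) (m∸n+n≡m b≤a)))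
    where
    regroup : ∀ u v → u + 1 + v ≡ u + v + 1
    regroup = solve-∀
  upper : length F ≤ bound (2 + s) (suc j)
  upper = +-cancelʳ-≤ b _ _ (≤-trans length-bound (≤-reflexive (sym bound+b)))
  module Case (3≤j : 3 ≤ j) (j<s : j < s) where
    forward : length F ≡ bound (2 + s) (suc j) → IsomorphicTo F (InFtilde (2 + s) (suc j))
    forward e =
      let tight = ≤-reflexive (trans (sym bound+b) (cong (_+ b) (sym e)))
          x , Y , Y∈F , x∉Y , wtY , only = lone-exception 3≤j j<s tight
      in Equality.isomorphic 3≤j j<s F unique sized intersecting nontrivial tight x Y Y∈F x∉Y wtY only
    backward : IsomorphicTo F (InFtilde (2 + s) (suc j)) → length F ≡ bound (2 + s) (suc j)
    backward (σ , iso) = ≤-antisym upper (+-cancelʳ-≤ b _ _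
      (≤-trans (≤-reflexive bound+b) (Extremal.length-lower-bound j≤s F sized σ iso)))
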